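{- For any integer $s\geq 3$, there exists some $\varepsilon>0$ (depending only on $s$) such that for any positive integer $t$ there is a constant $C_{s,t}$ depending only on $s$ and $t$ such that for all positive integers $n$, $$\mathrm{ex}(n,K_{s,t}^{(3)})\leq C_{s,t}\, n^{3-\frac{1}{s-1}-\varepsilon}.$$
   Context: For an $r$-uniform hypergraph $H$, $\mathrm{ex}(n,H)$ denotes the largest number of edges in an $r$-uniform hypergraph on $n$ vertices containing no copy of $H$ (as a not necessarily induced subhypergraph). For positive integers $s,t$, $K_{s,t}^{(3)}$ denotes the $3$-uniform hypergraph whose vertex set is the union of pairwise disjoint sets $X,Y_1,\dots,Y_t$ with $|X|=s$ and $|Y_1|=\dots=|Y_t|=2$, and whose edge set is $\{\{x\}\cup Y_i : x\in X,\ 1\leq i\leq t\}$. -}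

module Defs where

open import Data.Bool.Base using (true; false)
open import Data.Bool.Properties using () renaming (_≟_ to _≟ᵇ_)
open import Data.Empty using (⊥-elim)
open import Data.Fin.Base using (Fin; zero; suc; _↑ˡ_; _↑ʳ_; splitAt; combine; finToFun; funToFin)
open import Data.Fin.Properties
  using (_≟_; any?; all?; finToFun-funToFin; splitAt-↑ˡ; splitAt-↑ʳ; combine-injectiveʳ; ↑ʳ-injective)
open import Data.Fin.Subset using (Subset; inside; outside; _∈_; _∉_; ⁅_⁆; _∪_; ∣_∣)
open import Data.Fin.Subset.Properties
  using (_∈?_; x∈⁅y⁆⇒x≡y; x∈p∪q⁻; ∣⁅x⁆∣≡1; ∪-identityˡ)
open import Data.Integer.Base using (+_; -[1+_])
open import Data.List.Base using (List; []; _∷_; _++_; map; filter; length)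
open import Data.List.Extrema.Nat using (max; xs≤max; argmax-sel)
import Data.List.Membership.Propositional as List
open import Data.List.Membership.Propositional.Properties
  using (∈-map⁺; ∈-map⁻; ∈-++⁺ˡ; ∈-++⁺ʳ; ∈-filter⁺; ∈-filter⁻)
open import Data.List.Properties using (filter-≐; filter-none)
open import Data.List.Relation.Unary.All as All using (All)
import Data.List.Relation.Unary.Any as Any
open import Data.List.Relation.Unary.Any using (here)
open import Data.Nat.Base using (ℕ; zero; suc; _+_; _*_; _∸_; _^_; _≤_; NonZero; s≤s; z≤n)
open import Data.Nat.Properties using () renaming (_≟_ to _≟ⁿ_)
open import Data.Product.Base using (Σ; ∃; ∃₂; _×_; _,_; proj₁; proj₂)
open import Data.Rational.Unnormalised.Base using (ℚᵘ; mkℚᵘ)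
open import Data.Sum.Base using (inj₁; inj₂)
open import Data.Vec.Base using ([]; _∷_; here; there; tabulate)
open import Data.Vec.Properties using (≡-dec; tabulate-cong)
open import Function.Base using (_∘_)
open import Function.Definitions using (Injective)
open import Level using (0ℓ)
open import Relation.Binary.PropositionalEquality
  using (_≡_; _≢_; _≗_; refl; sym; trans; cong; subst)
open import Relation.Nullary using (Dec; does; ¬_)
open import Relation.Nullary.Decidable using (map′; ¬?; _×-dec_; _→-dec_; does-⇔)
open import Relation.Unary using (Pred; Decidable)

private
  variable
    m n r v : ℕ

_≟ˢ_ : (p q : Subset n) → Dec (p ≡ q)
_≟ˢ_ = ≡-dec _≟ᵇ_

subsets : ∀ n → List (Subset n)
subsets zero    = [] ∷ []
subsets (suc n) = map (inside ∷_) (subsets n) ++ map (outside ∷_) (subsets n)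

∈-subsets : (p : Subset n) → p List.∈ subsets n
∈-subsets []                  = here refl
∈-subsets (true  ∷ p)         = ∈-++⁺ˡ (∈-map⁺ _ (∈-subsets p))
∈-subsets {suc n} (false ∷ p) = ∈-++⁺ʳ (map (inside ∷_) (subsets n)) (∈-map⁺ _ (∈-subsets p))

image : (Fin m → Fin n) → Subset m → Subset n
image f p = tabulate λ j → does (any? λ i → (i ∈? p) ×-dec (f i ≟ j))

-- An r-uniform hypergraph on the vertex set Fin n.
record Hypergraph (r n : ℕ) : Set₁ where
  field
    Edge    : Pred (Subset n) 0ℓ
    Edge?   : Decidable Edge
    uniform : ∀ {e} → Edge e → ∣ e ∣ ≡ r

open Hypergraph

edgeCount : Hypergraph r n → ℕ
edgeCount {n = n} G = length (filter (Edge? G) (subsets n))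

-- A (not necessarily induced) copy of H in G.
IsCopy : Hypergraph r v → Hypergraph r n → (Fin v → Fin n) → Set
IsCopy H G f = Injective _≡_ _≡_ f × (∀ e → Edge H e → Edge G (image f e))

Contains : Hypergraph r n → Hypergraph r v → Set
Contains G H = ∃ (IsCopy H G)

Free : Hypergraph r v → Hypergraph r n → Set
Free H G = ¬ Contains G H

image-cong : {f g : Fin m → Fin n} → f ≗ g → image f ≗ image g
image-cong {f = f} {g} f≗g p = tabulate-cong λ j →
  does-⇔ (record
    { to        = λ { (i , i∈p , eq) → i , i∈p , trans (sym (f≗g i)) eq }
    ; from      = λ { (i , i∈p , eq) → i , i∈p , trans (f≗g i) eq }
    ; to-cong   = λ { refl → refl }
    ; from-cong = λ { refl → refl } })
    (any? λ i → (i ∈? p) ×-dec (f i ≟ j))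
    (any? λ i → (i ∈? p) ×-dec (g i ≟ j))

IsCopy-resp-≗ : (H : Hypergraph r v) (G : Hypergraph r n) {f g : Fin v → Fin n} →
                f ≗ g → IsCopy H G f → IsCopy H G g
IsCopy-resp-≗ H G f≗g (inj , edge) =
  (λ {x} {y} gx≡gy → inj (trans (f≗g x) (trans gx≡gy (sym (f≗g y))))) ,
  (λ e He → subst (Edge G) (image-cong f≗g e) (edge e He))

isCopy? : (H : Hypergraph r v) (G : Hypergraph r n) → Decidable (IsCopy H G)
isCopy? {v = v} H G f =
  map′ (λ inj {x} {y} → inj x y) (λ inj x y → inj {x} {y})
       (all? λ x → all? λ y → (f x ≟ f y) →-dec (x ≟ y))
  ×-dec
  map′ (λ all e → All.lookup all (∈-subsets e)) (λ h → All.tabulate λ {e} _ → h e)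
       (All.all? (λ e → Edge? H e →-dec Edge? G (image f e)) (subsets v))

contains? : (G : Hypergraph r n) (H : Hypergraph r v) → Dec (Contains G H)
contains? G H = map′
  (λ { (k , copy) → finToFun k , copy })
  (λ { (f , copy) → funToFin f , IsCopy-resp-≗ H G (λ i → sym (finToFun-funToFin f i)) copy })
  (any? λ k → isCopy? H G (finToFun k))

free? : (H : Hypergraph r v) → Decidable {A = Hypergraph r n} (Free H)
free? H G = ¬? (contains? G H)

-- The hypergraph whose edges are the members of es of size r.
fromList : ∀ r → List (Subset n) → Hypergraph r n
fromList r es = record
  { Edge    = λ e → e List.∈ es × ∣ e ∣ ≡ r
  ; Edge?   = λ e → Any.any? (e ≟ˢ_) es ×-dec (∣ e ∣ ≟ⁿ r)
  ; uniform = proj₂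
  }

sublists : {A : Set} → List A → List (List A)
sublists []       = [] ∷ []
sublists (x ∷ xs) = map (x ∷_) (sublists xs) ++ sublists xs

hypergraphs : ∀ r n → List (Hypergraph r n)
hypergraphs r n = map (fromList r) (sublists (subsets n))

-- If no hypergraph on n vertices is H-free (possible only when H has no
-- edges), the value is 0; otherwise ex-upper and ex-attained below say that
-- this is the largest number of edges of an H-free hypergraph.
ex : ℕ → Hypergraph r v → ℕ
ex {r = r} n H = max 0 (map edgeCount (filter (free? H) (hypergraphs r n)))

private
  filter∈sublists : {A : Set} {P : Pred A 0ℓ} (P? : Decidable P) (xs : List A) →
                    filter P? xs List.∈ sublists xs
  filter∈sublists P? []       = here refl
  filter∈sublists P? (x ∷ xs) with does (P? x)
  ... | true  = ∈-++⁺ˡ (∈-map⁺ _ (filter∈sublists P? xs))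
  ... | false = ∈-++⁺ʳ (map (x ∷_) (sublists xs)) (filter∈sublists P? xs)

  canonical : (G : Hypergraph r n) →
              Σ (Hypergraph r n) λ G′ → G′ List.∈ hypergraphs r n ×
              (∀ {e} → Edge G e → Edge G′ e) × (∀ {e} → Edge G′ e → Edge G e)
  canonical {r} {n} G =
    fromList r es , ∈-map⁺ (fromList r) (filter∈sublists (Edge? G) (subsets n)) ,
    (λ {e} Ge → ∈-filter⁺ (Edge? G) (∈-subsets e) Ge , uniform G Ge) ,
    (λ { (e∈es , _) → proj₂ (∈-filter⁻ (Edge? G) {xs = subsets n} e∈es) })
    where es = filter (Edge? G) (subsets n)

  canonical-free : (H : Hypergraph r v) (G : Hypergraph r n) → Free H G →
                   edgeCount G List.∈ map edgeCount (filter (free? H) (hypergraphs r n))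
  canonical-free {n = n} H G free with canonical G
  ... | G′ , G′∈ , to , from =
    subst (List._∈ _)
      (cong length (filter-≐ (Edge? G′) (Edge? G) (from , to) (subsets n)))
      (∈-map⁺ edgeCount (∈-filter⁺ (free? H) G′∈
        λ { (f , inj , edge) → free (f , inj , λ e He → from (edge e He)) }))

ex-upper : (H : Hypergraph r v) (G : Hypergraph r n) → Free H G → edgeCount G ≤ ex n H
ex-upper H G free = All.lookup (xs≤max 0 _) (canonical-free H G free)

ex-attained : (H : Hypergraph r v) {e : Subset v} → Edge H e →
              ∀ n → Σ (Hypergraph r n) λ G → Free H G × edgeCount G ≡ ex n H
ex-attained {r} H {e₀} He₀ n with argmax-sel (λ k → k) 0 (map edgeCount (filter (free? H) (hypergraphs r n)))
... | inj₁ ≡0 = fromList r [] , (λ { (_ , _ , edge) → noEdge (edge e₀ He₀) }) ,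
                trans (cong length (filter-none (Edge? (fromList r [])) (All.universal (λ _ → noEdge) (subsets n)))) (sym ≡0)
  where
  noEdge : ∀ {e : Subset n} → ¬ Edge (fromList r []) e
  noEdge (() , _)
... | inj₂ ∈xs with ∈-map⁻ edgeCount ∈xs
... | G , G∈ , eq = G , proj₂ (∈-filter⁻ (free? H) {xs = hypergraphs r n} G∈) , sym eq

-- The vertex set X ∪ Y₁ ∪ … ∪ Yₜ is Fin (s + t * 2): the first s vertices form
-- X, and Yᵢ = {y i 0 , y i 1}.
module _ {s t : ℕ} where

  x-vertex : Fin s → Fin (s + t * 2)
  x-vertex x = x ↑ˡ (t * 2)

  y-vertex : Fin t → Fin 2 → Fin (s + t * 2)
  y-vertex i j = s ↑ʳ combine i j

  K-edge : Fin s → Fin t → Subset (s + t * 2)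
  K-edge x i = ⁅ x-vertex x ⁆ ∪ (⁅ y-vertex i zero ⁆ ∪ ⁅ y-vertex i (suc zero) ⁆)

  x≢y : ∀ x i j → x-vertex x ≢ y-vertex i j
  x≢y x i j eq with trans (sym (splitAt-↑ˡ s x (t * 2)))
                          (trans (cong (splitAt s) eq) (splitAt-↑ʳ s (t * 2) (combine i j)))
  ... | ()

  y₀≢y₁ : ∀ i → y-vertex i zero ≢ y-vertex i (suc zero)
  y₀≢y₁ i eq with combine-injectiveʳ i zero i (suc zero) (↑ʳ-injective s _ _ eq)
  ... | ()

  ∣⁅x⁆∪p∣ : (x : Fin n) (p : Subset n) → x ∉ p → ∣ ⁅ x ⁆ ∪ p ∣ ≡ suc ∣ p ∣
  ∣⁅x⁆∪p∣ zero    (true  ∷ p) x∉p = ⊥-elim (x∉p here)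
  ∣⁅x⁆∪p∣ zero    (false ∷ p) x∉p = cong (suc ∘ ∣_∣) (∪-identityˡ p)
  ∣⁅x⁆∪p∣ (suc x) (true  ∷ p) x∉p = cong suc (∣⁅x⁆∪p∣ x p (x∉p ∘ there))
  ∣⁅x⁆∪p∣ (suc x) (false ∷ p) x∉p = ∣⁅x⁆∪p∣ x p (x∉p ∘ there)

  ∣K-edge∣≡3 : ∀ x i → ∣ K-edge x i ∣ ≡ 3
  ∣K-edge∣≡3 x i =
    trans (∣⁅x⁆∪p∣ (x-vertex x) _ x∉Y)
      (cong suc (trans (∣⁅x⁆∪p∣ (y-vertex i zero) _ (y₀≢y₁ i ∘ x∈⁅y⁆⇒x≡y _))
        (cong suc (∣⁅x⁆∣≡1 (y-vertex i (suc zero))))))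
    where
    x∉Y : x-vertex x ∉ ⁅ y-vertex i zero ⁆ ∪ ⁅ y-vertex i (suc zero) ⁆
    x∉Y x∈ with x∈p∪q⁻ ⁅ y-vertex i zero ⁆ ⁅ y-vertex i (suc zero) ⁆ x∈
    ... | inj₁ ∈₀ = x≢y x i zero (x∈⁅y⁆⇒x≡y _ ∈₀)
    ... | inj₂ ∈₁ = x≢y x i (suc zero) (x∈⁅y⁆⇒x≡y _ ∈₁)

K⁽³⁾ : (s t : ℕ) → Hypergraph 3 (s + t * 2)
K⁽³⁾ s t = record
  { Edge    = λ e → ∃₂ λ (x : Fin s) (i : Fin t) → e ≡ K-edge x i
  ; Edge?   = λ e → any? λ x → any? λ i → e ≟ˢ K-edge x i
  ; uniform = λ { (x , i , refl) → ∣K-edge∣≡3 x i }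
  }

-- a ≤ C · n ^ α for n ≥ 1 and rational α = p / q with q ≥ 1, raised to the
-- power q, with n ^ p moved to the left-hand side when p < 0.
-- Since n ≥ 1, "there are ε > 0 and C with a ≤ C · n ^ (β - ε)" means the same
-- for rational ε and natural C as for real ε and C: shrink ε and round C up.
infix 4 _≤_·_^ℚ_

_≤_·_^ℚ_ : ℕ → ℕ → ℕ → ℚᵘ → Set
a ≤ C · n ^ℚ mkℚᵘ (+ p)    q-1 = a ^ suc q-1 ≤ C ^ suc q-1 * n ^ p
a ≤ C · n ^ℚ mkℚᵘ -[1+ p ] q-1 = a ^ suc q-1 * n ^ suc p ≤ C ^ suc q-1

s∸1-nonZero : ∀ {s} → 3 ≤ s → NonZero (s ∸ 1)
s∸1-nonZero (s≤s (s≤s _)) = _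

{-# OPTIONS --safe #-}

-- Work with ordered triples of a hypergraph G without K⁽³⁾ s t, with nearly n ^ (3 - δ) edges,
-- δ = 1 / (s - 1), and write N(X) for the graph of pairs joined to all of a tuple
-- X of s vertices. For distinct entries, N(X) has no matching of size t, hence a
-- vertex cover of size 2t. Restricting to edges with suitable codegrees, all
-- codegrees are at most n ^ (1 - δ) up to small powers of n. Then for each role of
-- X, a dense set of edges xyz has many stars (X ; y , z), which must be centred at
-- the few cover vertices of N(X), so the link graphs of the y (or of the z) are
-- rich in 4-cycles. By dependent random choice inside such links one passes to a
-- dense set of edges where each X in the neighbourhood of (y , z) has more than 2t
-- common neighbours in the link of y, i.e. X forces y into every small cover;
-- write x → y for this. Both x → y and x → z cannot hold on a dense set, as N(X)
-- would always have boundedly many edges. But 4-cycles do not distinguish the two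
-- sides x and z of the link of y, so richness at y yields x → y as well as z → y.
-- Starting from x → y, the tuples of y's make the links of z or of x rich; the
-- former gives x → z, so we get z → x. Now the tuples of x's make the links of y
-- or z rich, which gives z → y or x → z: a contradiction in every case.
-- All powers of n are powers of an integer m with n ≤ m ^ q, so that losses and
-- constants are absorbed by factors of m.
module Submission where

open import Defs
open import Data.Nat.Base using (ℕ; _∸_; _≤_)
open import Data.Integer.Base using (+_)
open import Data.Rational.Unnormalised.Base using (ℚᵘ; 0ℚᵘ; _/_; _-_; _<_)
open import Data.Product.Base using (Σ; _×_)

open import Data.Bool.Base using (Bool; true; false; _∧_; T; if_then_else_)
open import Data.Bool.Properties using (T-∧; T?)
open import Data.Empty using (⊥; ⊥-elim)
open import Data.Fin.Base using (Fin; zero; suc; splitAt; combine; remQuot; _↑ʳ_; join)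
open import Data.Fin.Properties
  using (_≟_; any?; splitAt-↑ˡ; splitAt-↑ʳ; join-splitAt; remQuot-combine; combine-remQuot)
open import Data.Fin.Subset using (Subset; inside; outside; ⁅_⁆; _∪_; ∣_∣; _∈_) renaming (⊥ to ∅)
open import Data.Fin.Subset.Properties
  using (∪-comm; ∪-assoc; ∪-idem; ∪-identityˡ; ∪-identityʳ; ∣⁅x⁆∣≡1; x∈⁅x⁆; x∈⁅y⁆⇒x≡y;
         x∈p∪q⁻; x∈p∪q⁺; ⊆-antisym; _∈?_)
open import Data.Integer.Base as ℤ using (ℤ; _⊖_)
import Data.Integer.Properties as ℤ
open import Data.List.Base
  using (List; []; _∷_; _++_; map; length; allFin; filter; cartesianProductWith)
open import Data.List.Properties using (length-tabulate; map-tabulate)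
import Data.List.Membership.Propositional as List
open import Data.List.Membership.Propositional.Properties using (∈-cartesianProductWith⁺; ∈-allFin)
open import Data.List.Relation.Unary.Any using (here; there)
open import Data.Nat.Base
  using (zero; suc; pred; _+_; _*_; _^_; _≡ᵇ_; _≤ᵇ_; _<ᵇ_; z≤n; s≤s; NonZero; >-nonZero; >-nonZero⁻¹)
  renaming (_<_ to _<ⁿ_)
open import Data.Nat.Properties hiding (_≟_)
open import Data.Nat.Tactic.RingSolver using (solve-∀)
open import Data.Product.Base using (∃; ∃₂; _,_; proj₁; proj₂)
open import Data.Rational.Unnormalised.Base using (mkℚᵘ; *<*)
open import Data.Sum.Base using (_⊎_; inj₁; inj₂; [_,_]′)
open import Data.Unit.Base using (tt)
open import Data.Vec.Base using (Vec; []; _∷_; lookup)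
open import Data.Vec.Properties using ([]=⇒lookup; lookup⇒[]=; lookup∘tabulate)
open import Data.Vec.Relation.Unary.All as All using (All; []; _∷_)
open import Data.Vec.Relation.Unary.All.Properties using (lookup⁺)
open import Function.Base using (_∘_; id)
open import Function.Bundles using (Equivalence)
open import Relation.Binary.PropositionalEquality
  using (_≡_; _≢_; refl; sym; trans; cong; cong₂; subst; module ≡-Reasoning)
open import Relation.Nullary using (¬_; Dec; yes; no; does)
open import Relation.Nullary.Decidable using (_×-dec_; ¬?; dec-true)
open import Relation.Unary using (Decidable)

open Hypergraph

-- Finite sums and tuples

module _ {A : Set} where

  ∑ : List A → (A → ℕ) → ℕ
  ∑ []       f = 0
  ∑ (x ∷ xs) f = f x + ∑ xs f

  infix 5 ∑
  syntax ∑ xs (λ x → e) = ∑[ x ∈ xs ] e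

  ∑-mono : ∀ xs {f g : A → ℕ} → (∀ x → f x ≤ g x) → ∑ xs f ≤ ∑ xs g
  ∑-mono []       f≤g = z≤n
  ∑-mono (x ∷ xs) f≤g = +-mono-≤ (f≤g x) (∑-mono xs f≤g)

  ∑-cong : ∀ xs {f g : A → ℕ} → (∀ x → f x ≡ g x) → ∑ xs f ≡ ∑ xs g
  ∑-cong []       f≡g = refl
  ∑-cong (x ∷ xs) f≡g = cong₂ _+_ (f≡g x) (∑-cong xs f≡g)

  ∑-+ : ∀ xs (f g : A → ℕ) → (∑[ x ∈ xs ] (f x + g x)) ≡ ∑ xs f + ∑ xs g
  ∑-+ []       f g = refl
  ∑-+ (x ∷ xs) f g rewrite ∑-+ xs f g = interchange (f x) (g x) (∑ xs f) (∑ xs g)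
    where
    interchange : ∀ a b c d → (a + b) + (c + d) ≡ (a + c) + (b + d)
    interchange = solve-∀

  ∑-*ˡ : ∀ xs c (f : A → ℕ) → (∑[ x ∈ xs ] (c * f x)) ≡ c * ∑ xs f
  ∑-*ˡ []       c f = sym (*-zeroʳ c)
  ∑-*ˡ (x ∷ xs) c f = trans (cong (λ u → c * f x + u) (∑-*ˡ xs c f)) (sym (*-distribˡ-+ c (f x) (∑ xs f)))

  ∑-*ʳ : ∀ xs c (f : A → ℕ) → (∑[ x ∈ xs ] (f x * c)) ≡ ∑ xs f * c
  ∑-*ʳ xs c f = trans (∑-cong xs λ x → *-comm (f x) c) (trans (∑-*ˡ xs c f) (*-comm c (∑ xs f)))

  ∑-const : ∀ xs c → (∑[ x ∈ xs ] c) ≡ length xs * c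
  ∑-const []       c = refl
  ∑-const (x ∷ xs) c = cong (λ u → c + u) (∑-const xs c)

  ∑-zero : ∀ xs {f : A → ℕ} → (∀ x → f x ≡ 0) → ∑ xs f ≡ 0
  ∑-zero xs f≡0 = trans (∑-cong xs f≡0) (trans (∑-const xs 0) (*-zeroʳ (length xs)))

  ∑-bound : ∀ xs {f : A → ℕ} {c} → (∀ x → f x ≤ c) → ∑ xs f ≤ length xs * c
  ∑-bound xs f≤c = ≤-trans (∑-mono xs f≤c) (≤-reflexive (∑-const xs _))

  ∑-++ : ∀ xs ys (f : A → ℕ) → ∑ (xs ++ ys) f ≡ ∑ xs f + ∑ ys f
  ∑-++ []       ys f = refl
  ∑-++ (x ∷ xs) ys f = trans (cong (λ u → f x + u) (∑-++ xs ys f)) (sym (+-assoc (f x) _ _))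

  ∑-<⇒∃ : ∀ xs (f g : A → ℕ) → ∑ xs f <ⁿ ∑ xs g → ∃ λ x → f x <ⁿ g x
  ∑-<⇒∃ (x ∷ xs) f g lt with f x <? g x
  ... | yes fx<gx = x , fx<gx
  ... | no  fx≮gx = ∑-<⇒∃ xs f g (+-cancelˡ-< (f x) _ _ (<-≤-trans lt (+-monoˡ-≤ (∑ xs g) (≮⇒≥ fx≮gx))))

∑-map : ∀ {A B : Set} (h : A → B) xs (f : B → ℕ) → ∑ (map h xs) f ≡ ∑ xs (f ∘ h)
∑-map h []       f = refl
∑-map h (x ∷ xs) f = cong (λ u → f (h x) + u) (∑-map h xs f)

∑-swap : ∀ {A B : Set} xs ys (f : A → B → ℕ) →
         (∑[ x ∈ xs ] ∑[ y ∈ ys ] f x y) ≡ ∑[ y ∈ ys ] ∑[ x ∈ xs ] f x y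
∑-swap []       ys f = sym (∑-zero ys λ _ → refl)
∑-swap (x ∷ xs) ys f = trans (cong (λ u → ∑ ys (f x) + u) (∑-swap xs ys f))
                             (sym (∑-+ ys (f x) λ y → ∑[ x ∈ xs ] f x y))

∑-cartesianProductWith : ∀ {A B C : Set} (h : A → B → C) xs ys (f : C → ℕ) →
  ∑ (cartesianProductWith h xs ys) f ≡ ∑[ x ∈ xs ] ∑[ y ∈ ys ] f (h x y)
∑-cartesianProductWith h []       ys f = refl
∑-cartesianProductWith h (x ∷ xs) ys f =
  trans (∑-++ (map (h x) ys) _ f)
        (cong₂ _+_ (∑-map (h x) ys f) (∑-cartesianProductWith h xs ys f))

∑-*-∑ : ∀ {A B : Set} xs ys (f : A → ℕ) (g : B → ℕ) →
        ∑ xs f * ∑ ys g ≡ ∑[ x ∈ xs ] ∑[ y ∈ ys ] f x * g y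
∑-*-∑ xs ys f g = trans (sym (∑-*ʳ xs (∑ ys g) f)) (∑-cong xs λ x → sym (∑-*ˡ ys (f x) g))

ι : Bool → ℕ
ι b = if b then 1 else 0

ι≤1 : ∀ b → ι b ≤ 1
ι≤1 true  = ≤-refl
ι≤1 false = z≤n

ι-∧ : ∀ a b → ι (a ∧ b) ≡ ι a * ι b
ι-∧ true  b = sym (+-identityʳ (ι b))
ι-∧ false b = refl

T⇒ι≡1 : ∀ {b} → T b → ι b ≡ 1
T⇒ι≡1 {true} _ = refl

ι-mono : ∀ {a b} → (T a → T b) → ι a ≤ ι b
ι-mono {false}        _   = z≤n
ι-mono {true} {true}  _   = ≤-refl
ι-mono {true} {false} a⇒b = ⊥-elim (a⇒b tt)

-- Π f X is the product of f over the entries of X, so that Π (ι ∘ P) is the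
-- indicator of "all entries satisfy P".
module _ {A : Set} where

  Π : ∀ {k} → (A → ℕ) → Vec A k → ℕ
  Π f []      = 1
  Π f (x ∷ X) = f x * Π f X

  Π-cases : ∀ {k} (P : A → Bool) (X : Vec A k) →
            Π (ι ∘ P) X ≡ 0 ⊎ All (T ∘ P) X × Π (ι ∘ P) X ≡ 1
  Π-cases P []      = inj₂ ([] , refl)
  Π-cases P (x ∷ X) with P x in eq | Π-cases P X
  ... | false | _                = inj₁ refl
  ... | true  | inj₁ Π≡0         = inj₁ (trans (+-identityʳ _) Π≡0)
  ... | true  | inj₂ (all , Π≡1) = inj₂ (subst T (sym eq) tt ∷ all , trans (+-identityʳ _) Π≡1)

  Π-All : ∀ {k} (P : A → Bool) {X : Vec A k} → All (T ∘ P) X → Π (ι ∘ P) X ≡ 1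
  Π-All P []         = refl
  Π-All P (px ∷ all) = cong₂ _*_ (T⇒ι≡1 px) (Π-All P all)

  Π≤1 : ∀ {k} (P : A → Bool) (X : Vec A k) → Π (ι ∘ P) X ≤ 1
  Π≤1 P X with Π-cases P X
  ... | inj₁ eq       = ≤-trans (≤-reflexive eq) z≤n
  ... | inj₂ (_ , eq) = ≤-reflexive eq

  Π-cong : ∀ {k} {f g : A → ℕ} → (∀ x → f x ≡ g x) → (X : Vec A k) → Π f X ≡ Π g X
  Π-cong f≡g []      = refl
  Π-cong f≡g (x ∷ X) = cong₂ _*_ (f≡g x) (Π-cong f≡g X)

  Π-mono : ∀ {k} {f g : A → ℕ} → (∀ x → f x ≤ g x) → (X : Vec A k) → Π f X ≤ Π g X
  Π-mono f≤g []      = ≤-refl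
  Π-mono f≤g (x ∷ X) = *-mono-≤ (f≤g x) (Π-mono f≤g X)

  Π-* : ∀ {k} (f g : A → ℕ) (X : Vec A k) → Π (λ x → f x * g x) X ≡ Π f X * Π g X
  Π-* f g []      = refl
  Π-* f g (x ∷ X) rewrite Π-* f g X = interchange (f x) (g x) (Π f X) (Π g X)
    where
    interchange : ∀ a b c d → (a * b) * (c * d) ≡ (a * c) * (b * d)
    interchange = solve-∀

  Π-const1 : ∀ {k} (X : Vec A k) → Π (λ _ → 1) X ≡ 1
  Π-const1 []      = refl
  Π-const1 (x ∷ X) = trans (+-identityʳ _) (Π-const1 X)

  tuples : List A → ∀ k → List (Vec A k)
  tuples xs zero    = [] ∷ []
  tuples xs (suc k) = cartesianProductWith _∷_ xs (tuples xs k)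

  ∑-tuples : ∀ xs k (f : A → ℕ) → ∑ (tuples xs k) (Π f) ≡ ∑ xs f ^ k
  ∑-tuples xs zero    f = refl
  ∑-tuples xs (suc k) f = begin
    ∑ (tuples xs (suc k)) (Π f)                  ≡⟨ ∑-cartesianProductWith _∷_ xs (tuples xs k) (Π f) ⟩
    (∑[ x ∈ xs ] ∑[ X ∈ tuples xs k ] f x * Π f X) ≡⟨ ∑-*-∑ xs (tuples xs k) f (Π f) ⟨
    ∑ xs f * ∑ (tuples xs k) (Π f)               ≡⟨ cong (∑ xs f *_) (∑-tuples xs k f) ⟩
    ∑ xs f * ∑ xs f ^ k                          ∎
    where open ≡-Reasoning

  length-tuples : ∀ xs k → length (tuples xs k) ≡ length xs ^ k
  length-tuples xs k = begin
    length (tuples xs k)              ≡⟨ *-identityʳ _ ⟨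
    length (tuples xs k) * 1          ≡⟨ ∑-const (tuples xs k) 1 ⟨
    (∑[ X ∈ tuples xs k ] 1)          ≡⟨ ∑-cong (tuples xs k) (λ X → Π-const1 X) ⟨
    ∑ (tuples xs k) (Π λ _ → 1)       ≡⟨ ∑-tuples xs k (λ _ → 1) ⟩
    (∑[ x ∈ xs ] 1) ^ k               ≡⟨ cong (_^ k) (trans (∑-const xs 1) (*-identityʳ _)) ⟩
    length xs ^ k                     ∎
    where open ≡-Reasoning

Π-swap : ∀ {A B : Set} {k l} (w : A → B → ℕ) (X : Vec A k) (Y : Vec B l) →
         Π (λ x → Π (w x) Y) X ≡ Π (λ y → Π (λ x → w x y) X) Y
Π-swap w []      Y = sym (Π-const1 Y)
Π-swap w (x ∷ X) Y = trans (cong (Π (w x) Y *_) (Π-swap w X Y))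
                           (sym (Π-* (w x) (λ y → Π (λ x → w x y) X) Y))

∑-allFin-δ : ∀ {n} (u : Fin n) → (∑[ v ∈ allFin n ] ι (does (v ≟ u))) ≡ 1
∑-allFin-suc : ∀ {n} (f : Fin (suc n) → ℕ) → ∑ (allFin (suc n)) f ≡ f zero + ∑ (allFin n) (f ∘ suc)
∑-allFin-suc {n} f = cong (λ u → f zero + u)
  (trans (cong (λ xs → ∑ xs f) (sym (map-tabulate id suc))) (∑-map suc (allFin n) f))
∑-allFin-δ {suc n} zero    = trans (∑-allFin-suc {n} λ v → ι (does (v ≟ zero))) (cong suc (∑-zero (allFin n) λ _ → refl))
∑-allFin-δ {suc n} (suc u) = trans (∑-allFin-suc {n} λ v → ι (does (v ≟ suc u))) (trans (∑-cong (allFin n) λ v → cong ι (step v)) (∑-allFin-δ u))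
  where
  step : ∀ v → does (suc v ≟ suc u) ≡ does (v ≟ u)
  step v with v ≟ u
  ... | yes _ = refl
  ... | no  _ = refl

-- Tuples of distinct vertices

module _ {n : ℕ} where

  private
    vs = allFin n

  occurrences : ∀ {k} → Fin n → Vec (Fin n) k → ℕ
  occurrences x []      = 0
  occurrences x (y ∷ Y) = ι (does (x ≟ y)) + occurrences x Y

  distinct : ∀ {k} → Vec (Fin n) k → Bool
  distinct []      = true
  distinct (x ∷ X) = (occurrences x X ≡ᵇ 0) ∧ distinct X

  ∑-occurrences : ∀ {k} (X : Vec (Fin n) k) → (∑[ x ∈ vs ] occurrences x X) ≡ k
  ∑-occurrences []      = ∑-zero vs λ _ → refl
  ∑-occurrences (y ∷ Y) = trans (∑-+ vs _ _) (cong₂ _+_ (∑-allFin-δ y) (∑-occurrences Y))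

  -- Greedy choice: each new entry has to avoid fewer than `s` earlier ones. Losing `s` uniformly,
  -- rather than the current length, turns a falling factorial into a power.
  ∑-distinct-≥ : ∀ (P : Fin n → Bool) s k → k ≤ s →
    (∑ vs (ι ∘ P) ∸ s) ^ k ≤ ∑[ X ∈ tuples vs k ] ι (distinct X) * Π (ι ∘ P) X
  ∑-distinct-≥ P s zero    _   = ≤-refl
  ∑-distinct-≥ P s (suc k) k<s = begin
    d * d ^ k
      ≤⟨ *-monoʳ-≤ d (∑-distinct-≥ P s k (<⇒≤ k<s)) ⟩
    d * (∑[ X ∈ tuples vs k ] w X)
      ≡⟨ ∑-*ˡ (tuples vs k) d w ⟨
    (∑[ X ∈ tuples vs k ] d * w X)
      ≤⟨ ∑-mono (tuples vs k) (λ X → *-monoˡ-≤ (w X) (fresh X)) ⟩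
    (∑[ X ∈ tuples vs k ] (∑[ x ∈ vs ] p x * ι (occurrences x X ≡ᵇ 0)) * w X)
      ≡⟨ ∑-cong (tuples vs k) (λ X → sym (∑-*ʳ vs (w X) _)) ⟩
    (∑[ X ∈ tuples vs k ] ∑[ x ∈ vs ] p x * ι (occurrences x X ≡ᵇ 0) * w X)
      ≡⟨ ∑-swap (tuples vs k) vs _ ⟩
    (∑[ x ∈ vs ] ∑[ X ∈ tuples vs k ] p x * ι (occurrences x X ≡ᵇ 0) * w X)
      ≡⟨ ∑-cong vs (λ x → ∑-cong (tuples vs k) (λ X → regroup x X)) ⟩
    (∑[ x ∈ vs ] ∑[ X ∈ tuples vs k ] w (x ∷ X))
      ≡⟨ ∑-cartesianProductWith _∷_ vs (tuples vs k) w ⟨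
    (∑[ X ∈ tuples vs (suc k) ] w X) ∎
    where
    open ≤-Reasoning
    p = ι ∘ P
    d = ∑ vs p ∸ s
    w : ∀ {l} → Vec (Fin n) l → ℕ
    w X = ι (distinct X) * Π p X
    split : ∀ b l → ι b ≤ ι b * ι (l ≡ᵇ 0) + l
    split true  zero    = ≤-refl
    split true  (suc l) = s≤s z≤n
    split false l       = z≤n
    fresh : ∀ X → d ≤ ∑[ x ∈ vs ] p x * ι (occurrences x X ≡ᵇ 0)
    fresh X = m≤n+o⇒m∸n≤o (∑ vs p) s (begin
      ∑ vs p
        ≤⟨ ∑-mono vs (λ x → split (P x) (occurrences x X)) ⟩
      (∑[ x ∈ vs ] (p x * ι (occurrences x X ≡ᵇ 0) + occurrences x X))
        ≡⟨ ∑-+ vs _ _ ⟩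
      (∑[ x ∈ vs ] p x * ι (occurrences x X ≡ᵇ 0)) + (∑[ x ∈ vs ] occurrences x X)
        ≡⟨ cong (λ u → (∑[ x ∈ vs ] p x * ι (occurrences x X ≡ᵇ 0)) + u) (∑-occurrences X) ⟩
      (∑[ x ∈ vs ] p x * ι (occurrences x X ≡ᵇ 0)) + k
        ≤⟨ +-monoʳ-≤ _ (<⇒≤ k<s) ⟩
      (∑[ x ∈ vs ] p x * ι (occurrences x X ≡ᵇ 0)) + s
        ≡⟨ +-comm _ s ⟩
      s + (∑[ x ∈ vs ] p x * ι (occurrences x X ≡ᵇ 0)) ∎)
    regroup : ∀ x (X : Vec (Fin n) k) → p x * ι (occurrences x X ≡ᵇ 0) * w X ≡ w (x ∷ X)
    regroup x X rewrite ι-∧ (occurrences x X ≡ᵇ 0) (distinct X) =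
      reorder (p x) (ι (occurrences x X ≡ᵇ 0)) (ι (distinct X)) (Π p X)
      where
      reorder : ∀ a b c d → a * b * (c * d) ≡ (b * c) * (a * d)
      reorder = solve-∀

-- Ternary relations and their link graphs

*-^ : ∀ a b k → (a * b) ^ k ≡ a ^ k * b ^ k
*-^ a b zero    = refl
*-^ a b (suc k) rewrite *-^ a b k = interchange a b (a ^ k) (b ^ k)
  where
  interchange : ∀ a b c d → (a * b) * (c * d) ≡ (a * c) * (b * d)
  interchange = solve-∀

-- A substitute for convexity: either f lies below the threshold μ, or
-- f ^ s already dominates f * μ ^ (s - 1).
^-threshold : ∀ f μ k → f * μ ^ k ≤ μ ^ suc k + f ^ suc k
^-threshold f μ k with ≤-total f μ
... | inj₁ f≤μ = m≤n⇒m≤n+o (f ^ suc k) (*-monoˡ-≤ (μ ^ k) f≤μ)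
... | inj₂ μ≤f = m≤n⇒m≤o+n (μ ^ suc k) (*-monoʳ-≤ f (^-monoˡ-≤ k μ≤f))

-- The form of `^-threshold` that fits the count in `∑-distinct-≥`: above `μ`, which is at least
-- `2 * suc k`, subtracting `suc k` costs at most a factor 2 in the base.
∸-threshold : ∀ f μ k → 2 * suc k ≤ μ → f * μ ^ k ≤ μ ^ suc k + 2 ^ suc k * (f ∸ suc k) ^ suc k
∸-threshold f μ k 2s≤μ with ≤-total f μ
... | inj₁ f≤μ = m≤n⇒m≤n+o _ (*-monoˡ-≤ (μ ^ k) f≤μ)
... | inj₂ μ≤f = m≤n⇒m≤o+n (μ ^ suc k) (begin
  f * μ ^ k                           ≤⟨ *-monoʳ-≤ f (^-monoˡ-≤ k μ≤f) ⟩
  f ^ suc k                           ≤⟨ ^-monoˡ-≤ (suc k) half ⟩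
  (2 * (f ∸ suc k)) ^ suc k           ≡⟨ *-^ 2 (f ∸ suc k) (suc k) ⟩
  2 ^ suc k * (f ∸ suc k) ^ suc k     ∎)
  where
  open ≤-Reasoning
  half : f ≤ 2 * (f ∸ suc k)
  half = begin
    f                       ≡⟨ m+n∸n≡m f f ⟨
    f + f ∸ f               ≤⟨ ∸-monoʳ-≤ (f + f) (≤-trans 2s≤μ μ≤f) ⟩
    f + f ∸ 2 * suc k       ≡⟨ cong (λ e → f + e ∸ 2 * suc k) (+-identityʳ f) ⟨
    2 * f ∸ 2 * suc k       ≡⟨ *-distribˡ-∸ 2 f (suc k) ⟨
    2 * (f ∸ suc k)         ∎

module _ {n : ℕ} where

  Rel₃ : Set
  Rel₃ = Fin n → Fin n → Fin n → Bool

  infix 4 _⊆_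

  _⊆_ : Rel₃ → Rel₃ → Set
  E ⊆ F = ∀ x y z → T (E x y z) → T (F x y z)

  swap₁₂ swap₁₃ swap₂₃ : Rel₃ → Rel₃
  swap₁₂ E x y z = E y x z
  swap₁₃ E x y z = E z y x
  swap₂₃ E x y z = E x z y

  private
    vs = allFin n

  length-vs : length vs ≡ n
  length-vs = length-tabulate id

  total : Rel₃ → ℕ
  total E = ∑[ y ∈ vs ] ∑[ z ∈ vs ] ∑[ x ∈ vs ] ι (E x y z)

  total-swap₁₃ : ∀ E → total (swap₁₃ E) ≡ total E
  total-swap₁₃ E = ∑-cong vs λ y → ∑-swap vs vs λ z x → ι (E z y x)

  total-swap₂₃ : ∀ E → total (swap₂₃ E) ≡ total E
  total-swap₂₃ E = ∑-swap vs vs λ y z → ∑[ x ∈ vs ] ι (E x z y)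

  total-swap₁₂ : ∀ E → total (swap₁₂ E) ≡ total E
  total-swap₁₂ E = trans (total-swap₂₃ (swap₁₃ (swap₂₃ E)))
                         (trans (total-swap₁₃ (swap₂₃ E)) (total-swap₂₃ E))

  common : Rel₃ → Fin n → Fin n → Fin n → ℕ
  common E y z z′ = ∑[ x ∈ vs ] ι (E x y z) * ι (E x y z′)

  -- 4-cycles x z x′ z′ of the link graphs of all y, degenerate ones included.
  C₄ : Rel₃ → ℕ
  C₄ E = ∑[ y ∈ vs ] ∑[ z ∈ vs ] ∑[ z′ ∈ vs ] common E y z z′ * common E y z z′

  C₄-expand : ∀ E → C₄ E ≡ ∑[ y ∈ vs ] ∑[ z ∈ vs ] ∑[ z′ ∈ vs ] ∑[ x ∈ vs ] ∑[ x′ ∈ vs ]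
                             (ι (E x y z) * ι (E x y z′)) * (ι (E x′ y z) * ι (E x′ y z′))
  C₄-expand E = ∑-cong vs λ y → ∑-cong vs λ z → ∑-cong vs λ z′ → ∑-*-∑ vs vs _ _

  -- Once the square is expanded, a 4-cycle treats its two opposite pairs alike. Through this
  -- symmetry, rich links of the `y` yield x → y as well as z → y.
  C₄-swap₁₃ : ∀ E → C₄ (swap₁₃ E) ≡ C₄ E
  C₄-swap₁₃ E = trans (C₄-expand (swap₁₃ E)) (trans (∑-cong vs step) (sym (C₄-expand E)))
    where
    open ≡-Reasoning
    swap² : (f : Fin n → Fin n → Fin n → Fin n → ℕ) →
      (∑[ a ∈ vs ] ∑[ b ∈ vs ] ∑[ c ∈ vs ] ∑[ d ∈ vs ] f a b c d) ≡
      (∑[ c ∈ vs ] ∑[ d ∈ vs ] ∑[ a ∈ vs ] ∑[ b ∈ vs ] f a b c d)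
    swap² f = begin
      (∑[ a ∈ vs ] ∑[ b ∈ vs ] ∑[ c ∈ vs ] ∑[ d ∈ vs ] f a b c d)
        ≡⟨ ∑-cong vs (λ a → ∑-swap vs vs λ b c → ∑[ d ∈ vs ] f a b c d) ⟩
      (∑[ a ∈ vs ] ∑[ c ∈ vs ] ∑[ b ∈ vs ] ∑[ d ∈ vs ] f a b c d)
        ≡⟨ ∑-swap vs vs (λ a c → ∑[ b ∈ vs ] ∑[ d ∈ vs ] f a b c d) ⟩
      (∑[ c ∈ vs ] ∑[ a ∈ vs ] ∑[ b ∈ vs ] ∑[ d ∈ vs ] f a b c d)
        ≡⟨ ∑-cong vs (λ c → ∑-cong vs λ a → ∑-swap vs vs λ b d → f a b c d) ⟩
      (∑[ c ∈ vs ] ∑[ a ∈ vs ] ∑[ d ∈ vs ] ∑[ b ∈ vs ] f a b c d)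
        ≡⟨ ∑-cong vs (λ c → ∑-swap vs vs λ a d → ∑[ b ∈ vs ] f a b c d) ⟩
      (∑[ c ∈ vs ] ∑[ d ∈ vs ] ∑[ a ∈ vs ] ∑[ b ∈ vs ] f a b c d) ∎
    reorder : ∀ a b c d → (a * b) * (c * d) ≡ (a * c) * (b * d)
    reorder = solve-∀
    step : ∀ y → (∑[ z ∈ vs ] ∑[ z′ ∈ vs ] ∑[ x ∈ vs ] ∑[ x′ ∈ vs ]
                    (ι (E z y x) * ι (E z′ y x)) * (ι (E z y x′) * ι (E z′ y x′)))
               ≡ (∑[ z ∈ vs ] ∑[ z′ ∈ vs ] ∑[ x ∈ vs ] ∑[ x′ ∈ vs ]
                    (ι (E x y z) * ι (E x y z′)) * (ι (E x′ y z) * ι (E x′ y z′)))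
    step y = trans (swap² _) (∑-cong vs λ z → ∑-cong vs λ z′ → ∑-cong vs λ x → ∑-cong vs λ x′ →
      reorder (ι (E x y z)) (ι (E x′ y z)) (ι (E x y z′)) (ι (E x′ y z′)))

  record Bounded (B : ℕ) (E : Rel₃) : Set where
    field
      codegree₁ : ∀ y z → (∑[ x ∈ vs ] ι (E x y z)) ≤ B
      codegree₂ : ∀ x z → (∑[ y ∈ vs ] ι (E x y z)) ≤ B
      codegree₃ : ∀ x y → (∑[ z ∈ vs ] ι (E x y z)) ≤ B

  open Bounded public

  Bounded-⊆ : ∀ {B E F} → E ⊆ F → Bounded B F → Bounded B E
  Bounded-⊆ E⊆F bd = record
    { codegree₁ = λ y z → ≤-trans (∑-mono vs λ x → ι-mono (E⊆F x y z)) (codegree₁ bd y z)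
    ; codegree₂ = λ x z → ≤-trans (∑-mono vs λ y → ι-mono (E⊆F x y z)) (codegree₂ bd x z)
    ; codegree₃ = λ x y → ≤-trans (∑-mono vs λ z → ι-mono (E⊆F x y z)) (codegree₃ bd x y)
    }

  Bounded-swap₁₃ : ∀ {B E} → Bounded B E → Bounded B (swap₁₃ E)
  Bounded-swap₁₃ bd = record
    { codegree₁ = λ y z → codegree₃ bd z y
    ; codegree₂ = λ x z → codegree₂ bd z x
    ; codegree₃ = λ x y → codegree₁ bd y x }

  Bounded-swap₂₃ : ∀ {B E} → Bounded B E → Bounded B (swap₂₃ E)
  Bounded-swap₂₃ bd = record
    { codegree₁ = λ y z → codegree₁ bd z y
    ; codegree₂ = λ x z → codegree₃ bd x z
    ; codegree₃ = λ x y → codegree₂ bd x y }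

  stars : ℕ → Rel₃ → ℕ
  stars s E = ∑[ y ∈ vs ] ∑[ z ∈ vs ] ∑[ X ∈ tuples vs s ] ι (distinct X) * Π (λ x → ι (E x y z)) X

  -- The weight `w` marks the pairs that carry edges, and only these pay the threshold term. It is
  -- constantly 1 for dense relations and the indicator of `big` pairs in the codegree argument.
  stars-≥ : ∀ k (E : Rel₃) μ (w : Fin n → Fin n → ℕ) → 2 * suc k ≤ μ →
            (∀ x y z → T (E x y z) → 1 ≤ w y z) →
            total E * μ ^ k ≤ μ ^ suc k * (∑[ y ∈ vs ] ∑[ z ∈ vs ] w y z) + 2 ^ suc k * stars (suc k) E
  stars-≥ k E μ w 2s≤μ supp = begin
    total E * μ ^ k
      ≡⟨ pull (λ y z → f y z) ⟨
    (∑[ y ∈ vs ] ∑[ z ∈ vs ] f y z * μ ^ k)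
      ≤⟨ ∑-mono vs (λ y → ∑-mono vs λ z → pointwise y z) ⟩
    (∑[ y ∈ vs ] ∑[ z ∈ vs ] (μ ^ suc k * w y z + 2 ^ suc k * S y z))
      ≡⟨ ∑-cong vs (λ y → trans (∑-+ vs _ _) (cong₂ _+_ (∑-*ˡ vs (μ ^ suc k) (w y)) (∑-*ˡ vs (2 ^ suc k) (S y)))) ⟩
    (∑[ y ∈ vs ] (μ ^ suc k * ∑ vs (w y) + 2 ^ suc k * ∑ vs (S y)))
      ≡⟨ trans (∑-+ vs _ _) (cong₂ _+_ (∑-*ˡ vs (μ ^ suc k) λ y → ∑ vs (w y)) (∑-*ˡ vs (2 ^ suc k) λ y → ∑ vs (S y))) ⟩
    μ ^ suc k * (∑[ y ∈ vs ] ∑[ z ∈ vs ] w y z) + 2 ^ suc k * stars (suc k) E ∎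
    where
    open ≤-Reasoning
    f : Fin n → Fin n → ℕ
    f y z = ∑[ x ∈ vs ] ι (E x y z)
    S : Fin n → Fin n → ℕ
    S y z = ∑[ X ∈ tuples vs (suc k) ] ι (distinct X) * Π (λ x → ι (E x y z)) X
    pull : (g : Fin n → Fin n → ℕ) → (∑[ y ∈ vs ] ∑[ z ∈ vs ] g y z * μ ^ k) ≡ (∑[ y ∈ vs ] ∑[ z ∈ vs ] g y z) * μ ^ k
    pull g = trans (∑-cong vs λ y → ∑-*ʳ vs (μ ^ k) (g y)) (∑-*ʳ vs (μ ^ k) _)
    pointwise : ∀ y z → f y z * μ ^ k ≤ μ ^ suc k * w y z + 2 ^ suc k * S y z
    pointwise y z with w y z in eq
    ... | zero  = ≤-trans (≤-reflexive (cong (_* μ ^ k) (∑-zero vs none))) z≤n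
      where
      none : ∀ x → ι (E x y z) ≡ 0
      none x with E x y z in e
      ... | false = refl
      ... | true  = ⊥-elim (<⇒≱ (supp x y z (subst T (sym e) tt)) (≤-reflexive eq))
    ... | suc l = begin
      f y z * μ ^ k
        ≤⟨ ∸-threshold (f y z) μ k 2s≤μ ⟩
      μ ^ suc k + 2 ^ suc k * (f y z ∸ suc k) ^ suc k
        ≤⟨ +-mono-≤ (m≤m*n (μ ^ suc k) (suc l))
                    (*-monoʳ-≤ (2 ^ suc k) (∑-distinct-≥ (λ x → E x y z) (suc k) (suc k) ≤-refl)) ⟩
      μ ^ suc k * suc l + 2 ^ suc k * S y z ∎

  degree : ∀ {k} → Rel₃ → Fin n → Vec (Fin n) k → ℕ
  degree E y X = ∑[ z ∈ vs ] Π (λ x → ι (E x y z)) X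

  -- The relation x → y: tuples of x's joined to (y , z) force y into every vertex
  -- cover of size c, see Arrow⇒U.
  Arrow : ℕ → ℕ → Rel₃ → Rel₃ → Set
  Arrow s c G E = ∀ y z (X : Vec (Fin n) s) → All (λ x → T (E x y z)) X → c <ⁿ degree G y X

  -- Degrees are taken in the ambient `G`, so thinning out a relation keeps its arrow. This lets an
  -- earlier arrow be combined with a later one.
  Arrow-⊆ : ∀ {s c G E F} → E ⊆ F → Arrow s c G F → Arrow s c G E
  Arrow-⊆ E⊆F arrow y z X all = arrow y z X (All.map (λ {x} → E⊆F x y z) all)

  record Symmetric (G : Rel₃) : Set where
    field
      sym₁₂ : G ⊆ swap₁₂ G
      sym₂₃ : G ⊆ swap₂₃ G

  open Symmetric public

  -- The only form in which freeness enters the counting; `free⇒Covering` supplies it with `c` equal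
  -- to `t * 2`. Tuples with repeated entries are exempt, since a matching in their common graph
  -- gives no copy.
  record Covering (s c : ℕ) (G : Rel₃) : Set where
    field
      U      : Vec (Fin n) s → Fin n → Bool
      size   : ∀ X → (∑[ y ∈ vs ] ι (U X y)) ≤ c
      covers : ∀ X → T (distinct X) → ∀ y z → All (λ x → T (G x y z)) X → T (U X y) ⊎ T (U X z)

  stars-by-tuple : ∀ s E → stars s E ≡
    ∑[ X ∈ tuples vs s ] ∑[ y ∈ vs ] ∑[ z ∈ vs ] ι (distinct X) * Π (λ x → ι (E x y z)) X
  stars-by-tuple s E = trans
    (∑-cong vs λ y → ∑-swap vs (tuples vs s) λ z X → ι (distinct X) * Π (λ x → ι (E x y z)) X)
    (∑-swap vs (tuples vs s) λ y X → ∑[ z ∈ vs ] ι (distinct X) * Π (λ x → ι (E x y z)) X)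

  ∑-tuples-bound : ∀ {s N c} {f : Vec (Fin n) s → ℕ} → n ≤ N → (∀ X → f X ≤ c) → ∑ (tuples vs s) f ≤ N ^ s * c
  ∑-tuples-bound {s} {N} {c} {f} n≤N f≤c = begin
    ∑ (tuples vs s) f            ≤⟨ ∑-bound (tuples vs s) f≤c ⟩
    length (tuples vs s) * c     ≡⟨ cong (_* c) (trans (length-tuples vs s) (cong (_^ s) length-vs)) ⟩
    n ^ s * c                    ≤⟨ *-monoˡ-≤ c (^-monoˡ-≤ s n≤N) ⟩
    N ^ s * c                    ∎
    where open ≤-Reasoning

  ∑-vs-bound : ∀ {N c} {f : Fin n → ℕ} → n ≤ N → (∀ y → f y ≤ c) → ∑ vs f ≤ N * c
  ∑-vs-bound {N} {c} {f} n≤N f≤c = begin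
    ∑ vs f          ≤⟨ ∑-bound vs f≤c ⟩
    length vs * c   ≡⟨ cong (_* c) length-vs ⟩
    n * c           ≤⟨ *-monoˡ-≤ c n≤N ⟩
    N * c           ∎
    where open ≤-Reasoning

  -- Stars counted at the vertices of the covers

  module _ {s c : ℕ} {G : Rel₃} (cov : Covering s c G) where

    open Covering cov

    centred : Rel₃ → ℕ
    centred E = ∑[ X ∈ tuples vs s ] ∑[ y ∈ vs ] ι (U X y) * degree E y X

    -- One of the two ends of each star lies in the cover of its tuple. `swap₂₃` exchanges the ends,
    -- so the second term collects the stars centred at `z`.
    stars≤centred : ∀ E → E ⊆ G → stars s E ≤ centred E + centred (swap₂₃ E)
    stars≤centred E E⊆G = begin
      stars s E
        ≡⟨ stars-by-tuple s E ⟩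
      (∑[ X ∈ tuples vs s ] ∑[ y ∈ vs ] ∑[ z ∈ vs ] ι (distinct X) * star y z X)
        ≤⟨ ∑-mono (tuples vs s) (λ X → ∑-mono vs λ y → ∑-mono vs λ z → pointwise X y z) ⟩
      (∑[ X ∈ tuples vs s ] ∑[ y ∈ vs ] ∑[ z ∈ vs ] (ι (U X y) * star y z X + ι (U X z) * star y z X))
        ≡⟨ ∑-cong (tuples vs s) split ⟩
      (∑[ X ∈ tuples vs s ] ((∑[ y ∈ vs ] ι (U X y) * degree E y X) + (∑[ z ∈ vs ] ι (U X z) * degree (swap₂₃ E) z X)))
        ≡⟨ ∑-+ (tuples vs s) _ _ ⟩
      centred E + centred (swap₂₃ E) ∎
      where
      open ≤-Reasoning
      star : Fin n → Fin n → Vec (Fin n) s → ℕ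
      star y z X = Π (λ x → ι (E x y z)) X
      pointwise : ∀ X y z → ι (distinct X) * star y z X ≤ ι (U X y) * star y z X + ι (U X z) * star y z X
      pointwise X y z with distinct X in eq | Π-cases (λ x → E x y z) X
      ... | false | _                = z≤n
      ... | true  | inj₁ Π≡0 rewrite Π≡0 = z≤n
      ... | true  | inj₂ (all , Π≡1) rewrite Π≡1
            with covers X (subst T (sym eq) tt) y z (All.map (λ {x} → E⊆G x y z) all)
      ... | inj₁ Uy rewrite T⇒ι≡1 Uy = s≤s z≤n
      ... | inj₂ Uz rewrite T⇒ι≡1 Uz = m≤n+m 1 (ι (U X y) * 1)
      split : ∀ X → (∑[ y ∈ vs ] ∑[ z ∈ vs ] (ι (U X y) * star y z X + ι (U X z) * star y z X)) ≡
                    (∑[ y ∈ vs ] ι (U X y) * degree E y X) + (∑[ z ∈ vs ] ι (U X z) * degree (swap₂₃ E) z X)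
      split X = trans (∑-cong vs λ y → ∑-+ vs _ _) (trans (∑-+ vs _ _) (cong₂ _+_
        (∑-cong vs λ y → ∑-*ˡ vs (ι (U X y)) λ z → star y z X)
        (trans (∑-swap vs vs λ y z → ι (U X z) * star y z X)
               (∑-cong vs λ z → ∑-*ˡ vs (ι (U X z)) λ y → star y z X))))

    -- If `y` were outside the cover, all its neighbours in N(X) would have to lie inside, and these
    -- are more than `c`.
    Arrow⇒U : ∀ {y} {X : Vec (Fin n) s} → T (distinct X) → c <ⁿ degree G y X → T (U X y)
    Arrow⇒U {y} {X} dX heavy with U X y in eq
    ... | true  = tt
    ... | false = ⊥-elim (<⇒≱ heavy (≤-trans (∑-mono vs pointwise) (size X)))
      where
      pointwise : ∀ z → Π (λ x → ι (G x y z)) X ≤ ι (U X z)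
      pointwise z with Π-cases (λ x → G x y z) X
      ... | inj₁ Π≡0 rewrite Π≡0 = z≤n
      ... | inj₂ (all , Π≡1) with covers X dX y z all
      ... | inj₁ Uy = ⊥-elim (subst T eq Uy)
      ... | inj₂ Uz rewrite Π≡1 | T⇒ι≡1 Uz = ≤-refl

    -- Both ends of a star are forced into the cover of its tuple, which leaves at most `c * c`
    -- pairs for each tuple.
    stars≤-two-arrows : ∀ {N} E → n ≤ N → Arrow s c G E → Arrow s c G (swap₂₃ E) → stars s E ≤ N ^ s * (c * c)
    stars≤-two-arrows {N} E n≤N arrow₂ arrow₃ = begin
      stars s E
        ≡⟨ stars-by-tuple s E ⟩
      (∑[ X ∈ tuples vs s ] ∑[ y ∈ vs ] ∑[ z ∈ vs ] ι (distinct X) * Π (λ x → ι (E x y z)) X)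
        ≤⟨ ∑-mono (tuples vs s) (λ X → ∑-mono vs λ y → ∑-mono vs λ z → pointwise X y z) ⟩
      (∑[ X ∈ tuples vs s ] ∑[ y ∈ vs ] ∑[ z ∈ vs ] ι (U X y) * ι (U X z))
        ≡⟨ ∑-cong (tuples vs s) (λ X → sym (∑-*-∑ vs vs _ _)) ⟩
      (∑[ X ∈ tuples vs s ] (∑[ y ∈ vs ] ι (U X y)) * (∑[ z ∈ vs ] ι (U X z)))
        ≤⟨ ∑-tuples-bound n≤N (λ X → *-mono-≤ (size X) (size X)) ⟩
      N ^ s * (c * c) ∎
      where
      open ≤-Reasoning
      pointwise : ∀ X y z → ι (distinct X) * Π (λ x → ι (E x y z)) X ≤ ι (U X y) * ι (U X z)
      pointwise X y z with distinct X in eq | Π-cases (λ x → E x y z) X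
      ... | false | _                = z≤n
      ... | true  | inj₁ Π≡0 rewrite Π≡0 = z≤n
      ... | true  | inj₂ (all , Π≡1)
            rewrite Π≡1
                  | T⇒ι≡1 (Arrow⇒U {y} {X} (subst T (sym eq) tt) (arrow₂ y z X all))
                  | T⇒ι≡1 (Arrow⇒U {z} {X} (subst T (sym eq) tt) (arrow₃ z y X all)) = ≤-refl

    centred≤ : ∀ {N B} E → n ≤ N → (∀ y X → degree E y X ≤ B) → centred E ≤ N ^ s * (c * B)
    centred≤ {N} {B} E n≤N deg≤B = ∑-tuples-bound n≤N λ X → begin
      (∑[ y ∈ vs ] ι (U X y) * degree E y X)   ≤⟨ ∑-mono vs (λ y → *-monoʳ-≤ (ι (U X y)) (deg≤B y X)) ⟩
      (∑[ y ∈ vs ] ι (U X y) * B)              ≡⟨ ∑-*ʳ vs B _ ⟩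
      (∑[ y ∈ vs ] ι (U X y)) * B              ≤⟨ *-monoˡ-≤ B (size X) ⟩
      c * B                                    ∎
      where open ≤-Reasoning

    -- For a centre of degree d, the product μ d is at most μ² or at most d². The first is paid only
    -- by the `c` cover vertices of each tuple; the second is bounded by 4-cycles in `∑degree²≤C₄`.
    centred-threshold : ∀ {N} E μ → n ≤ N →
      μ * centred E ≤ N ^ s * (c * (μ * μ)) + (∑[ X ∈ tuples vs s ] ∑[ y ∈ vs ] degree E y X * degree E y X)
    centred-threshold {N} E μ n≤N = begin
      μ * centred E
        ≡⟨ trans (∑-cong (tuples vs s) (λ X → ∑-*ˡ vs μ _)) (∑-*ˡ (tuples vs s) μ _) ⟨
      (∑[ X ∈ tuples vs s ] ∑[ y ∈ vs ] μ * (ι (U X y) * degree E y X))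
        ≤⟨ ∑-mono (tuples vs s) (λ X → ∑-mono vs λ y → pointwise (U X y) (degree E y X)) ⟩
      (∑[ X ∈ tuples vs s ] ∑[ y ∈ vs ] (ι (U X y) * (μ * μ) + degree E y X * degree E y X))
        ≡⟨ trans (∑-cong (tuples vs s) λ X → ∑-+ vs _ _) (∑-+ (tuples vs s) _ _) ⟩
      (∑[ X ∈ tuples vs s ] ∑[ y ∈ vs ] ι (U X y) * (μ * μ)) + D
        ≤⟨ +-monoˡ-≤ D (∑-tuples-bound n≤N λ X →
             ≤-trans (≤-reflexive (∑-*ʳ vs (μ * μ) _)) (*-monoˡ-≤ (μ * μ) (size X))) ⟩
      N ^ s * (c * (μ * μ)) + D ∎
      where
      open ≤-Reasoning
      D = ∑[ X ∈ tuples vs s ] ∑[ y ∈ vs ] degree E y X * degree E y X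
      pointwise : ∀ u d → μ * (ι u * d) ≤ ι u * (μ * μ) + d * d
      pointwise false d = ≤-trans (≤-reflexive (*-zeroʳ μ)) z≤n
      pointwise true  d rewrite +-identityʳ d | +-identityʳ (μ * μ) with ≤-total d μ
      ... | inj₁ d≤μ = m≤n⇒m≤n+o (d * d) (*-monoʳ-≤ μ d≤μ)
      ... | inj₂ μ≤d = m≤n⇒m≤o+n (μ * μ) (*-monoˡ-≤ d μ≤d)

  -- After exchanging sums, a pair `z`, `z′` in the link of `y` is counted once for each tuple of
  -- common neighbours. Of the `2 + r` factors `common E y z z′`, all but two are bounded by `B`.
  ∑degree²≤C₄ : ∀ {B} r E → Bounded B E →
    (∑[ X ∈ tuples vs (2 + r) ] ∑[ y ∈ vs ] degree E y X * degree E y X) ≤ B ^ r * C₄ E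
  ∑degree²≤C₄ {B} r E bd = begin
    (∑[ X ∈ tuples vs s ] ∑[ y ∈ vs ] degree E y X * degree E y X)
      ≡⟨ ∑-swap (tuples vs s) vs _ ⟩
    (∑[ y ∈ vs ] ∑[ X ∈ tuples vs s ] degree E y X * degree E y X)
      ≡⟨ ∑-cong vs (λ y → ∑-cong (tuples vs s) λ X → trans (∑-*-∑ vs vs _ _)
           (∑-cong vs λ z → ∑-cong vs λ z′ → sym (Π-* (λ x → ι (E x y z)) (λ x → ι (E x y z′)) X))) ⟩
    (∑[ y ∈ vs ] ∑[ X ∈ tuples vs s ] ∑[ z ∈ vs ] ∑[ z′ ∈ vs ] Π (λ x → ι (E x y z) * ι (E x y z′)) X)
      ≡⟨ ∑-cong vs (λ y → trans (∑-swap (tuples vs s) vs _) (∑-cong vs λ z → ∑-swap (tuples vs s) vs _)) ⟩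
    (∑[ y ∈ vs ] ∑[ z ∈ vs ] ∑[ z′ ∈ vs ] ∑[ X ∈ tuples vs s ] Π (λ x → ι (E x y z) * ι (E x y z′)) X)
      ≡⟨ ∑-cong vs (λ y → ∑-cong vs λ z → ∑-cong vs λ z′ → ∑-tuples vs s _) ⟩
    (∑[ y ∈ vs ] ∑[ z ∈ vs ] ∑[ z′ ∈ vs ] common E y z z′ ^ s)
      ≤⟨ ∑-mono vs (λ y → ∑-mono vs λ z → ∑-mono vs λ z′ → pointwise y z z′) ⟩
    (∑[ y ∈ vs ] ∑[ z ∈ vs ] ∑[ z′ ∈ vs ] B ^ r * (common E y z z′ * common E y z z′))
      ≡⟨ trans (∑-cong vs λ y → trans (∑-cong vs λ z → ∑-*ˡ vs (B ^ r) λ z′ → common E y z z′ * common E y z z′)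
                                       (∑-*ˡ vs (B ^ r) λ z → ∑[ z′ ∈ vs ] common E y z z′ * common E y z z′))
               (∑-*ˡ vs (B ^ r) λ y → ∑[ z ∈ vs ] ∑[ z′ ∈ vs ] common E y z z′ * common E y z z′) ⟩
    B ^ r * C₄ E ∎
    where
    open ≤-Reasoning
    s = 2 + r
    common≤B : ∀ y z z′ → common E y z z′ ≤ B
    common≤B y z z′ = ≤-trans (∑-mono vs λ x → ≤-trans (*-monoʳ-≤ (ι (E x y z)) (ι≤1 (E x y z′))) (≤-reflexive (*-identityʳ _)))
                              (codegree₁ bd y z)
    pointwise : ∀ y z z′ → common E y z z′ ^ s ≤ B ^ r * (common E y z z′ * common E y z z′)
    pointwise y z z′ = begin
      d * (d * d ^ r)   ≡⟨ *-assoc d d (d ^ r) ⟨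
      d * d * d ^ r     ≡⟨ *-comm (d * d) (d ^ r) ⟩
      d ^ r * (d * d)   ≤⟨ *-monoˡ-≤ (d * d) (^-monoˡ-≤ r (common≤B y z z′)) ⟩
      B ^ r * (d * d)   ∎
      where d = common E y z z′

-- Dependent random choice

∑-∈ : ∀ {A : Set} {xs : List A} (f : A → ℕ) {x} → x List.∈ xs → f x ≤ ∑ xs f
∑-∈ f (here refl)            = m≤m+n (f _) _
∑-∈ f (there {x = y} x∈xs)   = m≤n⇒m≤o+n (f y) (∑-∈ f x∈xs)

module _ {n : ℕ} where

  private
    vs = allFin n

  ∈-vs : ∀ x → x List.∈ vs
  ∈-vs = ∈-allFin

  ∈-tuples : ∀ {k} (X : Vec (Fin n) k) → X List.∈ tuples vs k
  ∈-tuples []      = here refl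
  ∈-tuples (x ∷ X) = ∈-cartesianProductWith⁺ _∷_ (∈-allFin x) (∈-tuples X)

  codegree : Rel₃ → Fin n → Fin n → Fin n → ℕ
  codegree E y x₀ x = ∑[ z ∈ vs ] ι (E x₀ y z) * ι (E x y z)

  -- The number of 4-cycles x₀ z x z′ in the link of `y` through the edge x₀ z, degenerate ones
  -- included.
  cycles : Rel₃ → Fin n → Fin n → Fin n → ℕ
  cycles E y z x₀ = ∑[ x ∈ vs ] ι (E x y z) * codegree E y x₀ x

  C₄-by-edges : ∀ E → C₄ E ≡ ∑[ y ∈ vs ] ∑[ z ∈ vs ] ∑[ x₀ ∈ vs ] ι (E x₀ y z) * cycles E y z x₀
  C₄-by-edges E = trans (C₄-expand E) (∑-cong vs λ y → ∑-cong vs λ z → step y z)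
    where
    open ≡-Reasoning
    reorder : ∀ a b c d → (a * b) * (c * d) ≡ a * (c * (b * d))
    reorder = solve-∀
    step : ∀ y z → (∑[ z′ ∈ vs ] ∑[ x₀ ∈ vs ] ∑[ x ∈ vs ]
                      (ι (E x₀ y z) * ι (E x₀ y z′)) * (ι (E x y z) * ι (E x y z′)))
                 ≡ ∑[ x₀ ∈ vs ] ι (E x₀ y z) * cycles E y z x₀
    step y z = begin
      (∑[ z′ ∈ vs ] ∑[ x₀ ∈ vs ] ∑[ x ∈ vs ] (ι (E x₀ y z) * ι (E x₀ y z′)) * (ι (E x y z) * ι (E x y z′)))
        ≡⟨ trans (∑-swap vs vs _) (∑-cong vs λ x₀ → ∑-swap vs vs _) ⟩
      (∑[ x₀ ∈ vs ] ∑[ x ∈ vs ] ∑[ z′ ∈ vs ] (ι (E x₀ y z) * ι (E x₀ y z′)) * (ι (E x y z) * ι (E x y z′)))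
        ≡⟨ ∑-cong vs (λ x₀ → ∑-cong vs λ x → trans
             (∑-cong vs λ z′ → reorder (ι (E x₀ y z)) (ι (E x₀ y z′)) (ι (E x y z)) (ι (E x y z′)))
             (trans (∑-*ˡ vs (ι (E x₀ y z)) _) (cong (ι (E x₀ y z) *_) (∑-*ˡ vs (ι (E x y z)) _)))) ⟩
      (∑[ x₀ ∈ vs ] ∑[ x ∈ vs ] ι (E x₀ y z) * (ι (E x y z) * codegree E y x₀ x))
        ≡⟨ ∑-cong vs (λ x₀ → ∑-*ˡ vs (ι (E x₀ y z)) _) ⟩
      (∑[ x₀ ∈ vs ] ι (E x₀ y z) * cycles E y z x₀) ∎

  module _ {B : ℕ} {E : Rel₃ {n}} (bd : Bounded B E) where

    codegree≤ : ∀ y x₀ x → codegree E y x₀ x ≤ B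
    codegree≤ y x₀ x = ≤-trans
      (∑-mono vs λ z → ≤-trans (*-monoʳ-≤ (ι (E x₀ y z)) (ι≤1 (E x y z))) (≤-reflexive (*-identityʳ _)))
      (codegree₃ bd x₀ y)

    ∑-neighbours≤ : ∀ y z {c} {f : Fin n → ℕ} → (∀ x → f x ≤ c) → (∑[ x ∈ vs ] ι (E x y z) * f x) ≤ B * c
    ∑-neighbours≤ y z {c} {f} f≤c = begin
      (∑[ x ∈ vs ] ι (E x y z) * f x)  ≤⟨ ∑-mono vs (λ x → *-monoʳ-≤ (ι (E x y z)) (f≤c x)) ⟩
      (∑[ x ∈ vs ] ι (E x y z) * c)    ≡⟨ ∑-*ʳ vs c _ ⟩
      (∑[ x ∈ vs ] ι (E x y z)) * c    ≤⟨ *-monoˡ-≤ c (codegree₁ bd y z) ⟩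
      B * c                            ∎
      where open ≤-Reasoning

    cycles≤ : ∀ y z x₀ → cycles E y z x₀ ≤ B * B
    cycles≤ y z x₀ = ∑-neighbours≤ y z (codegree≤ y x₀)

  -- Dependent random choice in the link graph of y: for random Z in the
  -- neighbourhood of x₀, few tuples in the common neighbourhood of z and Z have
  -- at most c common neighbours; the heads of these tuples are deleted.
  module Pivot (k c B : ℕ) {G E : Rel₃ {n}} (E⊆G : E ⊆ G) (bd : Bounded B E) (y z x₀ : Fin n) where

    private
      s = suc k

    light : Vec (Fin n) s → Bool
    light X = degree G y X ≤ᵇ c

    neighbour : Vec (Fin n) s → Fin n → Bool
    neighbour Z x = E x y z ∧ (Π (λ z′ → ι (E x y z′)) Z ≡ᵇ 1)

    ι-neighbour : ∀ Z x → ι (neighbour Z x) ≡ ι (E x y z) * Π (λ z′ → ι (E x y z′)) Z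
    ι-neighbour Z x = trans (ι-∧ (E x y z) _) (cong (ι (E x y z) *_) step)
      where
      step : ι (Π (λ z′ → ι (E x y z′)) Z ≡ᵇ 1) ≡ Π (λ z′ → ι (E x y z′)) Z
      step with Π-cases (λ z′ → E x y z′) Z
      ... | inj₁ eq       rewrite eq = refl
      ... | inj₂ (_ , eq) rewrite eq = refl

    bad : Vec (Fin n) s → Fin n → ℕ
    bad Z x = ∑[ X ∈ tuples vs k ] ι (light (x ∷ X)) * Π (λ x′ → ι (neighbour Z x′)) X

    chosen : Vec (Fin n) s → Fin n → Bool
    chosen Z x = neighbour Z x ∧ (bad Z x ≡ᵇ 0)

    lightTuples : Vec (Fin n) s → ℕ
    lightTuples Z = ∑[ X ∈ tuples vs s ] ι (light X) * Π (λ x → ι (neighbour Z x)) X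

    chosen⇒E : ∀ Z x → T (chosen Z x) → T (E x y z)
    chosen⇒E Z x ch = proj₁ (Equivalence.to T-∧ (proj₁ (Equivalence.to (T-∧ {neighbour Z x}) ch)))

    -- A light tuple of chosen vertices would be counted in `bad` at its own head, where the count
    -- is 0. Deleting heads alone thus destroys all light tuples.
    chosen-heavy : ∀ Z (X : Vec (Fin n) s) → All (λ x → T (chosen Z x)) X → c <ⁿ degree G y X
    chosen-heavy Z (x ∷ X) (ch ∷ chs) with degree G y (x ∷ X) ≤? c
    ... | no  d≰c = ≰⇒> d≰c
    ... | yes d≤c = ⊥-elim (<⇒≱ (s≤s z≤n) (begin
      1                                                             ≡⟨ sym (cong₂ _*_ (T⇒ι≡1 (≤⇒≤ᵇ d≤c)) (Π-All (neighbour Z) nbs)) ⟩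
      ι (light (x ∷ X)) * Π (λ x′ → ι (neighbour Z x′)) X           ≤⟨ ∑-∈ (λ X → ι (light (x ∷ X)) * Π (λ x′ → ι (neighbour Z x′)) X) (∈-tuples X) ⟩
      bad Z x                                                       ≡⟨ ≡ᵇ⇒≡ (bad Z x) 0 (proj₂ (Equivalence.to (T-∧ {neighbour Z x}) ch)) ⟩
      0                                                             ∎))
      where
      open ≤-Reasoning
      nbs : All (λ x → T (neighbour Z x)) X
      nbs = All.map (λ {x} ch → proj₁ (Equivalence.to (T-∧ {neighbour Z x}) ch)) chs

    -- Each deleted neighbour is the head of a light tuple of neighbours, so no more vertices are
    -- deleted than there are such tuples.
    neighbours≤ : ∀ Z → (∑[ x ∈ vs ] ι (neighbour Z x)) ≤ (∑[ x ∈ vs ] ι (chosen Z x)) + lightTuples Z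
    neighbours≤ Z = begin
      (∑[ x ∈ vs ] ι (neighbour Z x))
        ≤⟨ ∑-mono vs (λ x → pointwise (neighbour Z x) (bad Z x)) ⟩
      (∑[ x ∈ vs ] (ι (chosen Z x) + ι (neighbour Z x) * bad Z x))
        ≡⟨ ∑-+ vs _ _ ⟩
      (∑[ x ∈ vs ] ι (chosen Z x)) + (∑[ x ∈ vs ] ι (neighbour Z x) * bad Z x)
        ≡⟨ cong (λ u → (∑[ x ∈ vs ] ι (chosen Z x)) + u) (sym byHead) ⟩
      (∑[ x ∈ vs ] ι (chosen Z x)) + lightTuples Z ∎
      where
      open ≤-Reasoning
      pointwise : ∀ a l → ι a ≤ ι (a ∧ (l ≡ᵇ 0)) + ι a * l
      pointwise false l       = z≤n
      pointwise true  zero    = s≤s z≤n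
      pointwise true  (suc l) = s≤s z≤n
      reorder : ∀ a b c → a * (b * c) ≡ b * (a * c)
      reorder = solve-∀
      byHead : lightTuples Z ≡ ∑[ x ∈ vs ] ι (neighbour Z x) * bad Z x
      byHead = trans (∑-cartesianProductWith (_∷_ {n = k}) vs (tuples vs k) (λ X → ι (light X) * Π (λ x → ι (neighbour Z x)) X)) (∑-cong vs λ x → trans
        (∑-cong (tuples vs k) λ X → reorder (ι (light (x ∷ X))) (ι (neighbour Z x)) (Π (λ x′ → ι (neighbour Z x′)) X))
        (∑-*ˡ (tuples vs k) (ι (neighbour Z x)) _))

    weight : Vec (Fin n) s → ℕ
    weight = Π (λ z′ → ι (E x₀ y z′))

    -- Exchanging sums fixes a light `X` in the neighbourhood of `z` first, with at most `B ^ s`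
    -- possibilities. Each entry of `Z` is then a common neighbour of `X`, which leaves at most
    -- `c ^ s` tuples `Z`.
    ∑-lightTuples : (∑[ Z ∈ tuples vs s ] weight Z * lightTuples Z) ≤ B ^ s * c ^ s
    ∑-lightTuples = begin
      (∑[ Z ∈ tuples vs s ] weight Z * lightTuples Z)
        ≡⟨ ∑-cong (tuples vs s) (λ Z → trans (sym (∑-*ˡ (tuples vs s) (weight Z) _)) (∑-cong (tuples vs s) λ X → expand Z X)) ⟩
      (∑[ Z ∈ tuples vs s ] ∑[ X ∈ tuples vs s ] ι (light X) * (Π p X * Π (q X) Z))
        ≡⟨ ∑-swap (tuples vs s) (tuples vs s) _ ⟩
      (∑[ X ∈ tuples vs s ] ∑[ Z ∈ tuples vs s ] ι (light X) * (Π p X * Π (q X) Z))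
        ≡⟨ ∑-cong (tuples vs s) (λ X → trans (∑-*ˡ (tuples vs s) (ι (light X)) _)
             (cong (ι (light X) *_) (trans (∑-*ˡ (tuples vs s) (Π p X) _) (cong (Π p X *_) (∑-tuples vs s (q X)))))) ⟩
      (∑[ X ∈ tuples vs s ] ι (light X) * (Π p X * ∑ vs (q X) ^ s))
        ≤⟨ ∑-mono (tuples vs s) bound ⟩
      (∑[ X ∈ tuples vs s ] Π p X * c ^ s)
        ≡⟨ ∑-*ʳ (tuples vs s) (c ^ s) (Π p) ⟩
      ∑ (tuples vs s) (Π p) * c ^ s
        ≡⟨ cong (_* c ^ s) (∑-tuples vs s p) ⟩
      ∑ vs p ^ s * c ^ s
        ≤⟨ *-monoˡ-≤ (c ^ s) (^-monoˡ-≤ s (codegree₁ bd y z)) ⟩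
      B ^ s * c ^ s ∎
      where
      open ≤-Reasoning
      p : Fin n → ℕ
      p x = ι (E x y z)
      q : Vec (Fin n) s → Fin n → ℕ
      q X z′ = ι (E x₀ y z′) * Π (λ x → ι (E x y z′)) X
      reorder : ∀ w l a b → w * (l * (a * b)) ≡ l * (a * (w * b))
      reorder = solve-∀
      expand : ∀ Z X → weight Z * (ι (light X) * Π (λ x → ι (neighbour Z x)) X) ≡ ι (light X) * (Π p X * Π (q X) Z)
      expand Z X = trans
        (cong (λ e → weight Z * (ι (light X) * e))
          (trans (Π-cong (ι-neighbour Z) X) (trans (Π-* p _ X)
            (cong (Π p X *_) (Π-swap (λ x z′ → ι (E x y z′)) X Z)))))
        (trans (reorder (weight Z) (ι (light X)) (Π p X) _)
          (cong (λ e → ι (light X) * (Π p X * e)) (sym (Π-* (λ z′ → ι (E x₀ y z′)) _ Z))))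
      q≤ : ∀ X → ∑ vs (q X) ≤ degree G y X
      q≤ X = ∑-mono vs λ z′ → ≤-trans (*-monoˡ-≤ (Π (λ x → ι (E x y z′)) X) (ι≤1 (E x₀ y z′)))
        (≤-trans (≤-reflexive (+-identityʳ _)) (Π-mono (λ x → ι-mono (E⊆G x y z′)) X))
      bound : ∀ X → ι (light X) * (Π p X * ∑ vs (q X) ^ s) ≤ Π p X * c ^ s
      bound X with light X in eq
      ... | false = z≤n
      ... | true  = ≤-trans (≤-reflexive (+-identityʳ _)) (*-monoʳ-≤ (Π p X)
        (^-monoˡ-≤ s (≤-trans (q≤ X) (≤ᵇ⇒≤ (degree G y X) c (subst T (sym eq) tt)))))

    ∑-weight : (∑[ Z ∈ tuples vs s ] weight Z) ≤ B ^ s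
    ∑-weight = ≤-trans (≤-reflexive (∑-tuples vs s _)) (^-monoˡ-≤ s (codegree₃ bd x₀ y))

    ∑-neighbours : (∑[ Z ∈ tuples vs s ] weight Z * (∑[ x ∈ vs ] ι (neighbour Z x)))
                   ≡ ∑[ x ∈ vs ] ι (E x y z) * codegree E y x₀ x ^ s
    ∑-neighbours = begin
      (∑[ Z ∈ tuples vs s ] weight Z * (∑[ x ∈ vs ] ι (neighbour Z x)))
        ≡⟨ ∑-cong (tuples vs s) (λ Z → trans (sym (∑-*ˡ vs (weight Z) _)) (∑-cong vs λ x → expand Z x)) ⟩
      (∑[ Z ∈ tuples vs s ] ∑[ x ∈ vs ] ι (E x y z) * Π (λ z′ → ι (E x₀ y z′) * ι (E x y z′)) Z)
        ≡⟨ ∑-swap (tuples vs s) vs _ ⟩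
      (∑[ x ∈ vs ] ∑[ Z ∈ tuples vs s ] ι (E x y z) * Π (λ z′ → ι (E x₀ y z′) * ι (E x y z′)) Z)
        ≡⟨ ∑-cong vs (λ x → trans (∑-*ˡ (tuples vs s) (ι (E x y z)) _) (cong (ι (E x y z) *_) (∑-tuples vs s _))) ⟩
      (∑[ x ∈ vs ] ι (E x y z) * codegree E y x₀ x ^ s) ∎
      where
      open ≡-Reasoning
      reorder : ∀ w a b → w * (a * b) ≡ a * (w * b)
      reorder = solve-∀
      expand : ∀ Z x → weight Z * ι (neighbour Z x) ≡ ι (E x y z) * Π (λ z′ → ι (E x₀ y z′) * ι (E x y z′)) Z
      expand Z x = trans (cong (weight Z *_) (ι-neighbour Z x))
        (trans (reorder (weight Z) (ι (E x y z)) _) (cong (ι (E x y z) *_) (sym (Π-* _ _ Z))))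

    -- A neighbour `x` of `z` survives for `codegree E y x₀ x ^ s` tuples `Z`. In place of
    -- convexity, the threshold costs `ν ^ s` for each of the at most `B` neighbours of `z`.
    ∑-neighbours-≥ : ∀ ν → cycles E y z x₀ * ν ^ k ≤
      B * ν ^ s + (∑[ Z ∈ tuples vs s ] weight Z * (∑[ x ∈ vs ] ι (neighbour Z x)))
    ∑-neighbours-≥ ν = begin
      cycles E y z x₀ * ν ^ k
        ≡⟨ ∑-*ʳ vs (ν ^ k) _ ⟨
      (∑[ x ∈ vs ] ι (E x y z) * codegree E y x₀ x * ν ^ k)
        ≤⟨ ∑-mono vs pointwise ⟩
      (∑[ x ∈ vs ] (ι (E x y z) * ν ^ s + ι (E x y z) * codegree E y x₀ x ^ s))
        ≡⟨ ∑-+ vs _ _ ⟩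
      (∑[ x ∈ vs ] ι (E x y z) * ν ^ s) + (∑[ x ∈ vs ] ι (E x y z) * codegree E y x₀ x ^ s)
        ≤⟨ +-mono-≤ (∑-neighbours≤ bd y z (λ _ → ≤-refl)) (≤-reflexive (sym ∑-neighbours)) ⟩
      B * ν ^ s + (∑[ Z ∈ tuples vs s ] weight Z * (∑[ x ∈ vs ] ι (neighbour Z x))) ∎
      where
      open ≤-Reasoning
      pointwise : ∀ x → ι (E x y z) * codegree E y x₀ x * ν ^ k ≤
                        ι (E x y z) * ν ^ s + ι (E x y z) * codegree E y x₀ x ^ s
      pointwise x = begin
        ι (E x y z) * d * ν ^ k                  ≡⟨ *-assoc (ι (E x y z)) d (ν ^ k) ⟩
        ι (E x y z) * (d * ν ^ k)                ≤⟨ *-monoʳ-≤ (ι (E x y z)) (^-threshold d ν k) ⟩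
        ι (E x y z) * (ν ^ s + d ^ s)            ≡⟨ *-distribˡ-+ (ι (E x y z)) (ν ^ s) (d ^ s) ⟩
        ι (E x y z) * ν ^ s + ι (E x y z) * d ^ s ∎
        where d = codegree E y x₀ x

    -- Averaging over `Z` with `weight`: some `Z` has at least `μ` more neighbours than light
    -- tuples, and at least `μ` vertices remain after the deletion.
    ∃-chosen : ∀ μ → B ^ s * c ^ s + B ^ s * μ <ⁿ (∑[ Z ∈ tuples vs s ] weight Z * (∑[ x ∈ vs ] ι (neighbour Z x))) →
               ∃ λ Z → μ ≤ ∑[ x ∈ vs ] ι (chosen Z x)
    ∃-chosen μ lt with ∑-<⇒∃ (tuples vs s) (λ Z → weight Z * (lightTuples Z + μ)) _ (≤-<-trans upper lt)
      where
      open ≤-Reasoning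
      upper : (∑[ Z ∈ tuples vs s ] weight Z * (lightTuples Z + μ)) ≤ B ^ s * c ^ s + B ^ s * μ
      upper = begin
        (∑[ Z ∈ tuples vs s ] weight Z * (lightTuples Z + μ))
          ≡⟨ trans (∑-cong (tuples vs s) λ Z → *-distribˡ-+ (weight Z) (lightTuples Z) μ) (∑-+ (tuples vs s) _ _) ⟩
        (∑[ Z ∈ tuples vs s ] weight Z * lightTuples Z) + (∑[ Z ∈ tuples vs s ] weight Z * μ)
          ≤⟨ +-mono-≤ ∑-lightTuples (≤-trans (≤-reflexive (∑-*ʳ (tuples vs s) μ weight)) (*-monoˡ-≤ μ ∑-weight)) ⟩
        B ^ s * c ^ s + B ^ s * μ ∎
    ... | Z , lt′ = Z , +-cancelʳ-≤ (lightTuples Z) _ _ (begin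
      μ + lightTuples Z                              ≡⟨ +-comm μ (lightTuples Z) ⟩
      lightTuples Z + μ                              ≤⟨ <⇒≤ (*-cancelˡ-< (weight Z) _ _ lt′) ⟩
      (∑[ x ∈ vs ] ι (neighbour Z x))                ≤⟨ neighbours≤ Z ⟩
      (∑[ x ∈ vs ] ι (chosen Z x)) + lightTuples Z   ∎)
      where open ≤-Reasoning

-- Dense relations and richness in 4-cycles

^-split : ∀ m {a b} → a ≤ b → ∃ λ l → b ≡ a + l × m ^ b ≡ m ^ a * m ^ l
^-split m {a} a≤b with m≤n⇒∃[o]m+o≡n a≤b
... | l , refl = l , refl , ^-distribˡ-+-* m a l

-- Kept abstract: the iterates of next are too large to unfold.
abstract

  -- The power of `m` lost in `centred⇒Rich`, on the way from `Dense e` to richness.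
  exponent : ℕ → ℕ → ℕ
  exponent s e = 2 + 2 * ((1 + e) * s)

  -- Adds the loss of `select`, which leads from `Rich f` to `Dense (1 + (f + s * (2 + f)))`. It
  -- also exceeds the lower bounds on `b` needed in between, so that `next s e ≤ b` is the only
  -- condition to carry along.
  next : ℕ → ℕ → ℕ
  next s e = 1 + (exponent s e + s * (2 + exponent s e))

  e≤next : ∀ s .{{_ : NonZero s}} e → e ≤ next s e
  e≤next s e = ≤-trans (n≤1+n e) (≤-trans (m≤m*n (1 + e) s) (≤-trans (m≤n*m ((1 + e) * s) 2)
    (≤-trans (m≤n+m _ 3) (m≤m+n (1 + exponent s e) _))))

-- With B = `m ^ b` and s = `2 + r`, dividing `key` by N² B gives N^(s-2) ≤ B^(s-1): the codegree
-- bound is at least N^(1 - 1/(s-1)). The other inequalities let single factors of `m` absorb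
-- constants.
module Regime {n : ℕ} (r c m N b : ℕ) .{{_ : NonZero m}} .{{_ : NonZero N}} .{{_ : NonZero c}}
  (n≤N : n ≤ N)
  (key : N ^ (2 + r) * m ^ b ≤ N * N * (m ^ b) ^ (2 + r))
  (4≤m : 4 ≤ m) (2^s<m : 2 ^ (2 + r) <ⁿ m) (2s≤m : 2 * (2 + r) ≤ m)
  (4c≤m : 4 * c ≤ m) (c²<m : c * c <ⁿ m) (c^s≤m : c ^ (2 + r) ≤ m)
  {G : Rel₃ {n}} where

  private
    vs = allFin n
    s = 2 + r
    k = 1 + r
    B = m ^ b

  -- Up to a factor m ^ e, the relation E is as large as codegrees B allow.
  Dense : ℕ → Rel₃ {n} → Set
  Dense e E = N * N * B ≤ m ^ e * total E

  -- With codegrees at most `B` there are at most N² B edges, each on at most B² of these 4-cycles.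
  -- Richness says that this maximum is reached up to `m ^ f`.
  Rich : ℕ → Rel₃ {n} → Set
  Rich f E = N * N * (B * B * B) ≤ m ^ f * C₄ E

  m≤m^1+ : ∀ l → m ≤ m ^ suc l
  m≤m^1+ l = m≤m*n m (m ^ l) {{m^n≢0 m l}}

  -- Put μ = B / m^(1+e). Density makes `total E` at least m N² μ, so pairs of codegree below μ hold
  -- a small share and `stars-≥` yields about N² μ^s stars.
  Dense⇒stars : ∀ e E → 2 + e ≤ b → Dense e E → N * N * B ^ s ≤ m ^ ((1 + e) * s) * stars s E
  Dense⇒stars e E 2+e≤b dense with ^-split m {1 + e} (<⇒≤ 2+e≤b)
  -- The hypothesis `2 + e ≤ b` rules out μ = 1. Otherwise μ is at least `m`, and `2s≤m` gives the
  -- threshold required by `stars-≥`.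
  ... | zero  , b≡ , _ = ⊥-elim (<⇒≱ 2+e≤b (≤-reflexive (trans b≡ (+-identityʳ _))))
  ... | suc l , _ , B≡ = begin
    N * N * B ^ s                           ≡⟨ cong (λ e → N * N * e ^ s) B≡ ⟩
    N * N * (m ^ (1 + e) * μ) ^ s           ≡⟨ cong (N * N *_) (trans (*-^ (m ^ (1 + e)) μ s) (cong (_* μ ^ s) (^-*-assoc m (1 + e) s))) ⟩
    N * N * (m ^ ((1 + e) * s) * μ ^ s)     ≡⟨ lemma₃ (N * N) (m ^ ((1 + e) * s)) (μ ^ s) ⟩
    m ^ ((1 + e) * s) * Q                   ≤⟨ *-monoʳ-≤ (m ^ ((1 + e) * s)) Q≤T ⟩
    m ^ ((1 + e) * s) * stars s E           ∎
    where
    open ≤-Reasoning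
    μ = m ^ suc l
    Q = μ ^ s * (N * N)
    lemma₁ : ∀ e m μ p N → e * (m * ((μ * p) * (N * N))) ≡ (N * N * ((m * e) * μ)) * p
    lemma₁ = solve-∀
    lemma₃ : ∀ a b c → a * (b * c) ≡ b * (c * a)
    lemma₃ = solve-∀
    mQ≤ : m * Q ≤ Q + 2 ^ s * stars s E
    mQ≤ = *-cancelˡ-≤ (m ^ e) {{m^n≢0 m e}} (begin
      m ^ e * (m * Q)                            ≡⟨ lemma₁ (m ^ e) m μ (μ ^ k) N ⟩
      N * N * (m ^ (1 + e) * μ) * μ ^ k          ≡⟨ cong (λ B → N * N * B * μ ^ k) B≡ ⟨
      N * N * B * μ ^ k                          ≤⟨ *-monoˡ-≤ (μ ^ k) dense ⟩
      m ^ e * total E * μ ^ k                    ≡⟨ *-assoc (m ^ e) (total E) (μ ^ k) ⟩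
      m ^ e * (total E * μ ^ k)                  ≤⟨ *-monoʳ-≤ (m ^ e) (stars-≥ k E μ (λ _ _ → 1) (≤-trans 2s≤m (m≤m^1+ l)) (λ _ _ _ _ → ≤-refl)) ⟩
      m ^ e * (μ ^ s * (∑[ y ∈ vs ] ∑[ z ∈ vs ] 1) + 2 ^ s * stars s E)
        ≤⟨ *-monoʳ-≤ (m ^ e) (+-monoˡ-≤ (2 ^ s * stars s E) (*-monoʳ-≤ (μ ^ s)
             (∑-vs-bound n≤N λ y → ≤-trans (∑-vs-bound n≤N λ z → ≤-refl) (≤-reflexive (*-identityʳ N))))) ⟩
      m ^ e * (Q + 2 ^ s * stars s E)            ∎)
    Q≤T : Q ≤ stars s E
    Q≤T = *-cancelˡ-≤ (2 ^ s) {{m^n≢0 2 s}} (+-cancelˡ-≤ Q _ _ (begin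
      Q + 2 ^ s * Q           ≤⟨ *-monoˡ-≤ Q 2^s<m ⟩
      m * Q                   ≤⟨ mQ≤ ⟩
      Q + 2 ^ s * stars s E   ∎))

  Dense⇒stars′ : ∀ e E → 2 + e ≤ b → Dense e E → N ^ s * B ≤ m ^ ((1 + e) * s) * stars s E
  Dense⇒stars′ e E 2+e≤b dense = ≤-trans key (Dense⇒stars e E 2+e≤b dense)

  -- Density gives at least N^s B / m^h stars, where h = `(1 + e) * s`, and the two arrows allow at
  -- most N^s c². But B ≥ m^(h+1) > m^h c².
  ¬two-arrows : Covering s c G → ∀ e E → (1 + e) * s <ⁿ b → 2 + e ≤ b → Dense e E →
                Arrow s c G E → Arrow s c G (swap₂₃ E) → ⊥
  ¬two-arrows cov e E h<b 2+e≤b dense arrow₂ arrow₃ = <-irrefl refl (begin-strict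
    m ^ h * (c * c)   <⟨ *-monoʳ-< (m ^ h) {{m^n≢0 m h}} c²<m ⟩
    m ^ h * m         ≡⟨ *-comm (m ^ h) m ⟩
    m ^ suc h         ≤⟨ ^-monoʳ-≤ m h<b ⟩
    B                 ≤⟨ B≤ ⟩
    m ^ h * (c * c)   ∎)
    where
    open ≤-Reasoning
    h = (1 + e) * s
    lemma : ∀ a b c → a * (b * c) ≡ b * (a * c)
    lemma = solve-∀
    B≤ : B ≤ m ^ h * (c * c)
    B≤ = *-cancelˡ-≤ (N ^ s) {{m^n≢0 N s}} (begin
      N ^ s * B                      ≤⟨ Dense⇒stars′ e E 2+e≤b dense ⟩
      m ^ h * stars s E              ≤⟨ *-monoʳ-≤ (m ^ h) (stars≤-two-arrows cov E n≤N arrow₂ arrow₃) ⟩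
      m ^ h * (N ^ s * (c * c))      ≡⟨ lemma (m ^ h) (N ^ s) (c * c) ⟩
      N ^ s * (m ^ h * (c * c))      ∎)

  -- Take μ = B / m^(h+1) with h = `(1 + e) * s`, so that the centred count H is at least N^s m μ /
  -- 2. In `centred-threshold` the term N^s c μ² is then at most half of μ H, the squared degrees
  -- account for the rest, and `∑degree²≤C₄` turns them into 4-cycles.
  centred⇒Rich : (cov : Covering s c G) → ∀ e E → (1 + e) * s <ⁿ b → 2 + e ≤ b → Dense e E → Bounded B E →
                 stars s E ≤ 2 * centred cov E → Rich (2 + 2 * ((1 + e) * s)) E
  centred⇒Rich cov e E h<b 2+e≤b dense bd T≤2H with ^-split m h<b
  ... | l , _ , B≡ = *-cancelˡ-≤ (B ^ r) {{m^n≢0 B r}} (begin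
    B ^ r * (N * N * (B * B * B))              ≡⟨ lemma₁ (B ^ r) N B ⟩
    N * N * B ^ s * B                          ≤⟨ *-monoˡ-≤ B (Dense⇒stars e E 2+e≤b dense) ⟩
    m ^ h * T′ * B                              ≡⟨ cong (m ^ h * T′ *_) B≡ ⟩
    m ^ h * T′ * (m * m ^ h * μ)                ≡⟨ lemma₂ (m ^ h) T′ m μ ⟩
    m * (m ^ h * m ^ h) * (μ * T′)              ≤⟨ *-monoʳ-≤ (m * (m ^ h * m ^ h)) μT≤ ⟩
    m * (m ^ h * m ^ h) * (m * (B ^ r * C₄ E)) ≡⟨ lemma₃ m (m ^ h * m ^ h) (B ^ r) (C₄ E) ⟩
    B ^ r * (m * (m * (m ^ h * m ^ h)) * C₄ E) ≡⟨ cong (λ p → B ^ r * (m * (m * p) * C₄ E)) (sym (trans (cong (m ^_) (cong (λ u → h + u) (+-identityʳ h))) (^-distribˡ-+-* m h h))) ⟩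
    B ^ r * (m ^ (2 + 2 * h) * C₄ E)           ∎)
    where
    open ≤-Reasoning
    h = (1 + e) * s
    T′ = stars s E
    H = centred cov E
    μ = m ^ l
    D = B ^ r * C₄ E
    instance
      B-nonZero : NonZero B
      B-nonZero = m^n≢0 m b
    lemma₁ : ∀ p N B → p * (N * N * (B * B * B)) ≡ N * N * (B * (B * p)) * B
    lemma₁ = solve-∀
    lemma₂ : ∀ a t m μ → a * t * (m * a * μ) ≡ m * (a * a) * (μ * t)
    lemma₂ = solve-∀
    lemma₃ : ∀ m a p q → m * a * (m * (p * q)) ≡ p * (m * (m * a) * q)
    lemma₃ = solve-∀
    lemma₄ : ∀ a n m μ → a * (n * m * μ) ≡ n * (m * a * μ)
    lemma₄ = solve-∀
    lemma₅ : ∀ c p μ → c * 4 * (p * μ) ≡ 4 * c * p * μ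
    lemma₅ = solve-∀
    Nmμ≤2H : N ^ s * m * μ ≤ 2 * H
    Nmμ≤2H = ≤-trans (*-cancelˡ-≤ (m ^ h) {{m^n≢0 m h}} (begin
      m ^ h * (N ^ s * m * μ)        ≡⟨ lemma₄ (m ^ h) (N ^ s) m μ ⟩
      N ^ s * (m ^ suc h * μ)        ≡⟨ cong (N ^ s *_) B≡ ⟨
      N ^ s * B                      ≤⟨ Dense⇒stars′ e E 2+e≤b dense ⟩
      m ^ h * T′                     ∎)) T≤2H
    lemma₆ : ∀ c n μ → 4 * c * (n * (c * (μ * μ))) ≡ c * μ * (n * (4 * c) * μ)
    lemma₆ = solve-∀
    lemma₇ : ∀ c μ H → c * μ * (2 * H) ≡ 2 * c * (μ * H)
    lemma₇ = solve-∀
    lemma₈ : ∀ c d → 4 * c * d ≡ 2 * c * (2 * d)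
    lemma₈ = solve-∀
    small : 2 * (N ^ s * (c * (μ * μ))) ≤ μ * H
    small = *-cancelˡ-≤ (2 * c) {{m*n≢0 2 c}} (begin
      2 * c * (2 * (N ^ s * (c * (μ * μ))))  ≡⟨ lemma₈ c (N ^ s * (c * (μ * μ))) ⟨
      4 * c * (N ^ s * (c * (μ * μ)))        ≡⟨ lemma₆ c (N ^ s) μ ⟩
      c * μ * (N ^ s * (4 * c) * μ)          ≤⟨ *-monoʳ-≤ (c * μ) (*-monoˡ-≤ μ (*-monoʳ-≤ (N ^ s) 4c≤m)) ⟩
      c * μ * (N ^ s * m * μ)                ≤⟨ *-monoʳ-≤ (c * μ) Nmμ≤2H ⟩
      c * μ * (2 * H)                        ≡⟨ lemma₇ c μ H ⟩
      2 * c * (μ * H)                        ∎)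
    μH≤2D : μ * H ≤ 2 * D
    μH≤2D = +-cancelˡ-≤ (μ * H) _ _ (begin
      μ * H + μ * H                                 ≡⟨ cong (λ u → μ * H + u) (+-identityʳ (μ * H)) ⟨
      2 * (μ * H)                                   ≤⟨ *-monoʳ-≤ 2 (≤-trans (centred-threshold cov E μ n≤N) (+-monoʳ-≤ (N ^ s * (c * (μ * μ))) (∑degree²≤C₄ r E bd))) ⟩
      2 * (N ^ s * (c * (μ * μ)) + D)               ≡⟨ *-distribˡ-+ 2 (N ^ s * (c * (μ * μ))) D ⟩
      2 * (N ^ s * (c * (μ * μ))) + 2 * D           ≤⟨ +-monoˡ-≤ (2 * D) small ⟩
      μ * H + 2 * D                                 ∎)
    lemma₉ : ∀ μ H → μ * (2 * H) ≡ 2 * (μ * H)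
    lemma₉ = solve-∀
    μT≤ : μ * T′ ≤ m * D
    μT≤ = begin
      μ * T′             ≤⟨ *-monoʳ-≤ μ T≤2H ⟩
      μ * (2 * H)        ≡⟨ lemma₉ μ H ⟩
      2 * (μ * H)        ≤⟨ *-monoʳ-≤ 2 μH≤2D ⟩
      2 * (2 * D)        ≡⟨ *-assoc 2 2 D ⟨
      4 * D              ≤⟨ *-monoˡ-≤ D 4≤m ⟩
      m * D              ∎

  -- The end at which more stars are centred carries at least half of them, as `centred⇒Rich`
  -- requires.
  Dense⇒Rich : Covering s c G → ∀ e E → (1 + e) * s <ⁿ b → 2 + e ≤ b → E ⊆ G → Dense e E → Bounded B E →
               Rich (2 + 2 * ((1 + e) * s)) E ⊎ Rich (2 + 2 * ((1 + e) * s)) (swap₂₃ E)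
  Dense⇒Rich cov e E h<b 2+e≤b E⊆G dense bd
    with ≤-total (centred cov (swap₂₃ E)) (centred cov E)
  ... | inj₁ H₃≤H₂ = inj₁ (centred⇒Rich cov e E h<b 2+e≤b dense bd (begin
    stars s E                                      ≤⟨ stars≤centred cov E E⊆G ⟩
    centred cov E + centred cov (swap₂₃ E)         ≤⟨ +-monoʳ-≤ (centred cov E) H₃≤H₂ ⟩
    centred cov E + centred cov E                  ≡⟨ cong (λ u → centred cov E + u) (+-identityʳ (centred cov E)) ⟨
    2 * centred cov E                              ∎))
    where open ≤-Reasoning
  ... | inj₂ H₂≤H₃ = inj₂ (centred⇒Rich cov e (swap₂₃ E) h<b 2+e≤b
    (subst (λ t → N * N * B ≤ m ^ e * t) (sym (total-swap₂₃ E)) dense) (Bounded-swap₂₃ bd) (begin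
    stars s (swap₂₃ E)                             ≡⟨ ∑-swap vs vs (λ y z → ∑[ X ∈ tuples vs s ] ι (distinct X) * Π (λ x → ι (E x z y)) X) ⟩
    stars s E                                      ≤⟨ stars≤centred cov E E⊆G ⟩
    centred cov E + centred cov (swap₂₃ E)         ≤⟨ +-monoˡ-≤ (centred cov (swap₂₃ E)) H₂≤H₃ ⟩
    centred cov (swap₂₃ E) + centred cov (swap₂₃ E) ≡⟨ cong (λ u → centred cov (swap₂₃ E) + u) (+-identityʳ (centred cov (swap₂₃ E))) ⟨
    2 * centred cov (swap₂₃ E)                     ∎))
    where open ≤-Reasoning

  private
    pairs-≤ : (f : Fin n → Fin n → ℕ) (g : Fin n → Fin n → ℕ) (a d : ℕ) →
              (∀ y z → f y z ≤ a + d * g y z) →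
              (∑[ y ∈ vs ] ∑[ z ∈ vs ] f y z) ≤ N * (N * a) + d * (∑[ y ∈ vs ] ∑[ z ∈ vs ] g y z)
    pairs-≤ f g a d f≤ = begin
      (∑[ y ∈ vs ] ∑[ z ∈ vs ] f y z)
        ≤⟨ ∑-mono vs (λ y → ∑-mono vs (f≤ y)) ⟩
      (∑[ y ∈ vs ] ∑[ z ∈ vs ] (a + d * g y z))
        ≡⟨ ∑-cong vs (λ y → trans (∑-+ vs (λ _ → a) (λ z → d * g y z)) (cong (λ u → (∑[ z ∈ vs ] a) + u) (∑-*ˡ vs d (g y)))) ⟩
      (∑[ y ∈ vs ] ((∑[ z ∈ vs ] a) + d * ∑ vs (g y)))
        ≡⟨ trans (∑-+ vs (λ _ → ∑[ z ∈ vs ] a) (λ y → d * ∑ vs (g y))) (cong (λ u → (∑[ y ∈ vs ] ∑[ z ∈ vs ] a) + u) (∑-*ˡ vs d λ y → ∑ vs (g y))) ⟩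
      (∑[ y ∈ vs ] ∑[ z ∈ vs ] a) + d * (∑[ y ∈ vs ] ∑[ z ∈ vs ] g y z)
        ≤⟨ +-monoˡ-≤ _ (∑-vs-bound n≤N λ y → ∑-vs-bound n≤N λ z → ≤-refl) ⟩
      N * (N * a) + d * (∑[ y ∈ vs ] ∑[ z ∈ vs ] g y z) ∎
      where open ≤-Reasoning

  -- From 4-cycles to arrows

  module _ (f : ℕ) {E : Rel₃ {n}} (E⊆G : E ⊆ G) (bd : Bounded B E) where

    private
      g = s * (2 + f)

    -- `large` merges two cases. If every edge over the pair lies on fewer than `θ` cycles, the
    -- first term suffices and nothing is selected; otherwise at least B / m^g vertices are selected
    -- and the second term is at least the trivial bound B³. The sum over all pairs then needs no
    -- case distinction.
    record Selection (y z : Fin n) (θ : ℕ) : Set where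
      field
        selected : Fin n → Bool
        sound    : ∀ x → T (selected x) → T (E x y z)
        heavy    : ∀ (X : Vec (Fin n) s) → All (λ x → T (selected x)) X → c <ⁿ degree G y X
        large    : (∑[ x ∈ vs ] ι (E x y z) * cycles E y z x) ≤ B * θ + B * B * m ^ g * (∑[ x ∈ vs ] ι (selected x))

    open Selection

    -- Any `x₀` on sufficiently many cycles serves as pivot. In terms of `B` the parameters are μ =
    -- B / m^g, ν = B / m^(2+f) and a threshold m B ν = B² / m^(1+f) for the cycles.
    select-pair : ∀ l y z → B ≡ m ^ suc g * m ^ l → Selection y z (m * (B * (m ^ (k * (2 + f)) * m ^ suc l)))
    select-pair l y z B≡ with any? (λ x₀ → T? (E x₀ y z) ×-dec (m * (B * (m ^ (k * (2 + f)) * m ^ suc l)) ≤? cycles E y z x₀))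
    ... | no  none = record
      { selected = λ _ → false
      ; sound    = λ _ ()
      ; heavy    = λ { (x ∷ X) (() ∷ _) }
      ; large    = m≤n⇒m≤n+o _ (≤-trans (∑-mono vs pointwise)
          (∑-neighbours≤ bd y z λ _ → ≤-refl))
      }
      where
      pointwise : ∀ x → ι (E x y z) * cycles E y z x ≤ ι (E x y z) * (m * (B * (m ^ (k * (2 + f)) * m ^ suc l)))
      pointwise x with E x y z in eq
      ... | false = z≤n
      ... | true  = +-monoˡ-≤ 0 (<⇒≤ (≰⇒> λ θ≤ → none (x , subst T (sym eq) tt , θ≤)))
    ... | yes (x₀ , _ , θ≤cycles) = record
      { selected = chosen Z
      ; sound    = chosen⇒E Z
      ; heavy    = chosen-heavy Z
      ; large    = m≤n⇒m≤o+n (B * (m * (B * ν))) (begin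
          (∑[ x ∈ vs ] ι (E x y z) * cycles E y z x)             ≤⟨ ∑-neighbours≤ bd y z (cycles≤ bd y z) ⟩
          B * (B * B)                                             ≡⟨ cong (λ e → B * (B * e)) B≡m^g*μ ⟩
          B * (B * (m ^ g * μ))                                   ≡⟨ lemma₁ B (m ^ g) μ ⟩
          B * B * m ^ g * μ                                       ≤⟨ *-monoʳ-≤ (B * B * m ^ g) (proj₂ choice) ⟩
          B * B * m ^ g * (∑[ x ∈ vs ] ι (chosen Z x))            ∎)
      }
      where
      open ≤-Reasoning
      open Pivot k c B E⊆G bd y z x₀
      μ = m ^ suc l
      ν = m ^ (k * (2 + f)) * μ
      W = B * ν ^ s
      lemma₁ : ∀ B p μ → B * (B * (p * μ)) ≡ B * B * p * μ
      lemma₁ = solve-∀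
      lemma₂ : ∀ m p q → m * p * q ≡ p * (m * q)
      lemma₂ = solve-∀
      lemma₃ : ∀ p q μ → p * q * μ ≡ p * μ * q
      lemma₃ = solve-∀
      lemma₄ : ∀ m B ν p → m * (B * ν) * p ≡ m * (B * (ν * p))
      lemma₄ = solve-∀
      B≡m^g*μ : B ≡ m ^ g * μ
      B≡m^g*μ = trans B≡ (lemma₂ m (m ^ g) (m ^ l))
      B≡m^2+f*ν : B ≡ m ^ (2 + f) * ν
      B≡m^2+f*ν = trans B≡m^g*μ (trans (cong (_* μ) (^-distribˡ-+-* m (2 + f) (k * (2 + f)))) (*-assoc (m ^ (2 + f)) _ μ))
      -- The exponent `g` is `s * (2 + f)` for the sake of this identity: (B / ν)^s = m^g = B / μ.
      -- It puts the gain and the losses of the random choice on one scale `W`.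
      B^s*μ≡W : B ^ s * μ ≡ W
      B^s*μ≡W = begin-equality
        B ^ s * μ                         ≡⟨ cong (λ e → e ^ s * μ) B≡m^2+f*ν ⟩
        (m ^ (2 + f) * ν) ^ s * μ         ≡⟨ cong (_* μ) (*-^ (m ^ (2 + f)) ν s) ⟩
        (m ^ (2 + f)) ^ s * ν ^ s * μ     ≡⟨ cong (λ e → e * ν ^ s * μ) (trans (^-*-assoc m (2 + f) s) (cong (m ^_) (*-comm (2 + f) s))) ⟩
        m ^ g * ν ^ s * μ                 ≡⟨ lemma₃ (m ^ g) (ν ^ s) μ ⟩
        m ^ g * μ * ν ^ s                 ≡⟨ cong (_* ν ^ s) B≡m^g*μ ⟨
        W                                 ∎
      R = ∑[ Z ∈ tuples vs s ] weight Z * (∑[ x ∈ vs ] ι (neighbour Z x))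
      W>0 : 0 <ⁿ W
      W>0 = >-nonZero⁻¹ W {{m*n≢0 B (ν ^ s) {{m^n≢0 m b}} {{m^n≢0 ν s {{m*n≢0 _ μ {{m^n≢0 m (k * (2 + f))}} {{m^n≢0 m (suc l)}}}}}}}}
      -- Of 4 copies of `W`, one pays for the threshold ν. Two of the other three cover the light
      -- tuples and μ, and the last makes the inequality in `choice` strict.
      3W≤R : 3 * W ≤ R
      3W≤R = +-cancelˡ-≤ W _ _ (begin
        4 * W                                       ≤⟨ *-monoˡ-≤ W 4≤m ⟩
        m * W                                       ≡⟨ lemma₄ m B ν (ν ^ k) ⟨
        m * (B * ν) * ν ^ k                         ≤⟨ *-monoˡ-≤ (ν ^ k) θ≤cycles ⟩
        cycles E y z x₀ * ν ^ k                     ≤⟨ ∑-neighbours-≥ ν ⟩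
        W + R                                       ∎)
      choice : ∃ λ Z → μ ≤ ∑[ x ∈ vs ] ι (chosen Z x)
      choice = ∃-chosen μ (begin-strict
        B ^ s * c ^ s + B ^ s * μ   ≤⟨ +-monoˡ-≤ (B ^ s * μ) (*-monoʳ-≤ (B ^ s) (≤-trans c^s≤m (m≤m^1+ l))) ⟩
        B ^ s * μ + B ^ s * μ       ≡⟨ cong₂ _+_ B^s*μ≡W B^s*μ≡W ⟩
        W + W                       <⟨ m<n+m (W + W) W>0 ⟩
        W + (W + W)                 ≡⟨ cong (λ e → W + (W + e)) (+-identityʳ W) ⟨
        3 * W                       ≤⟨ 3W≤R ⟩
        R                           ∎)
      Z = proj₁ choice

    -- Over all pairs the first terms of `large` add up to N² B θ = N² B³ / m^(1+f), by richness at
    -- most `C₄ E` / m. The second terms therefore carry at least half of the cycles, and they add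
    -- up to B² m^g times the size of `F`.
    select : g <ⁿ b → Rich f E → ∃ λ F → F ⊆ E × Dense (1 + (f + g)) F × Arrow s c G F
    select g<b rich with ^-split m g<b
    ... | l , _ , B≡ = F , (λ x y z → sound (S y z) x) , dense , (λ y z → heavy (S y z))
      where
      open ≤-Reasoning
      ν = m ^ (k * (2 + f)) * m ^ suc l
      θ = m * (B * ν)
      S : ∀ y z → Selection y z θ
      S y z = select-pair l y z B≡
      F : Rel₃
      F x y z = selected (S y z) x
      Y = m ^ f * (N * (N * (B * θ)))
      lemma₁ : ∀ m p B ν N → m * (p * (N * (N * (B * (m * (B * ν)))))) ≡ N * N * (B * (B * (m * (m * p) * ν)))
      lemma₁ = solve-∀
      lemma₂ : ∀ m p q B t → m * (p * (B * B * q * t)) ≡ B * B * (m * (p * q) * t)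
      lemma₂ = solve-∀
      lemma₃ : ∀ N B → B * B * (N * N * B) ≡ N * N * (B * B * B)
      lemma₃ = solve-∀
      lemma₄ : ∀ m p q r → m * p * (q * r) ≡ q * (m * (p * r))
      lemma₄ = solve-∀
      B≡m^2+f*ν : B ≡ m * (m * m ^ f) * ν
      B≡m^2+f*ν = trans B≡ (trans (cong (λ e → m * e * m ^ l) (^-distribˡ-+-* m (2 + f) (k * (2 + f))))
        (lemma₅ m (m ^ (2 + f)) (m ^ (k * (2 + f))) (m ^ l)))
        where
        lemma₅ : ∀ m p q r → m * (p * q) * r ≡ p * (q * (m * r))
        lemma₅ = solve-∀
      N²B³≡mY : N * N * (B * B * B) ≡ m * Y
      N²B³≡mY = begin-equality
        N * N * (B * B * B)                               ≡⟨ cong (N * N *_) (*-assoc B B B) ⟩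
        N * N * (B * (B * B))                             ≡⟨ cong (λ e → N * N * (B * (B * e))) B≡m^2+f*ν ⟩
        N * N * (B * (B * (m * (m * m ^ f) * ν)))         ≡⟨ lemma₁ m (m ^ f) B ν N ⟨
        m * Y                                             ∎
      C₄≤ : C₄ E ≤ N * (N * (B * θ)) + B * B * m ^ g * total F
      C₄≤ = ≤-trans (≤-reflexive (C₄-by-edges E))
        (pairs-≤ (λ y z → ∑[ x ∈ vs ] ι (E x y z) * cycles E y z x) (λ y z → ∑[ x ∈ vs ] ι (F x y z)) (B * θ) (B * B * m ^ g)
          λ y z → large (S y z))
      Y≤ : Y ≤ m ^ f * (B * B * m ^ g * total F)
      Y≤ = +-cancelˡ-≤ Y _ _ (begin
        Y + Y                                                   ≡⟨ cong (λ u → Y + u) (+-identityʳ Y) ⟨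
        2 * Y                                                   ≤⟨ *-monoˡ-≤ Y (≤-trans (s≤s (s≤s z≤n)) 4≤m) ⟩
        m * Y                                                   ≡⟨ N²B³≡mY ⟨
        N * N * (B * B * B)                                     ≤⟨ rich ⟩
        m ^ f * C₄ E                                            ≤⟨ *-monoʳ-≤ (m ^ f) C₄≤ ⟩
        m ^ f * (N * (N * (B * θ)) + B * B * m ^ g * total F)   ≡⟨ *-distribˡ-+ (m ^ f) (N * (N * (B * θ))) _ ⟩
        Y + m ^ f * (B * B * m ^ g * total F)                   ∎)
      dense : N * N * B ≤ m ^ (1 + (f + g)) * total F
      dense = *-cancelˡ-≤ (B * B) {{m*n≢0 B B {{m^n≢0 m b}} {{m^n≢0 m b}}}} (begin
        B * B * (N * N * B)                              ≡⟨ lemma₃ N B ⟩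
        N * N * (B * B * B)                              ≡⟨ N²B³≡mY ⟩
        m * Y                                            ≤⟨ *-monoʳ-≤ m Y≤ ⟩
        m * (m ^ f * (B * B * m ^ g * total F))          ≡⟨ lemma₂ m (m ^ f) (m ^ g) B (total F) ⟩
        B * B * (m * (m ^ f * m ^ g) * total F)          ≡⟨ cong (λ e → B * B * (m * e * total F)) (^-distribˡ-+-* m f g) ⟨
        B * B * (m ^ (1 + (f + g)) * total F)            ∎)

  -- Arrows between the three roles

  module Contradiction (symG : Symmetric G) (cov : Covering s c G) where

    abstract

      private
        next≤⇒h< : ∀ e → next s e ≤ b → (1 + e) * s <ⁿ b
        next≤⇒h< e = ≤-trans (s≤s (≤-trans (m≤n+m ((1 + e) * s) 2)
          (≤-trans (+-monoʳ-≤ 2 (m≤n*m ((1 + e) * s) 2)) (m≤m+n (exponent s e) _))))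

        next≤⇒2+e≤ : ∀ e → next s e ≤ b → 2 + e ≤ b
        next≤⇒2+e≤ e next≤b = ≤-trans (s≤s (m≤m*n (1 + e) s)) (next≤⇒h< e next≤b)

      enrich : ∀ e {E} → next s e ≤ b → E ⊆ G → Bounded B E → Dense e E →
               Rich (exponent s e) E ⊎ Rich (exponent s e) (swap₂₃ E)
      enrich e {E} next≤b E⊆G bd dense =
        Dense⇒Rich cov e E (next≤⇒h< e next≤b) (next≤⇒2+e≤ e next≤b) E⊆G dense bd

      refine : ∀ e {E} → next s e ≤ b → E ⊆ G → Bounded B E → Rich (exponent s e) E →
               ∃ λ F → F ⊆ E × Dense (next s e) F × Arrow s c G F
      refine e next≤b E⊆G bd rich =
        select (exponent s e) E⊆G bd (≤-trans (s≤s (m≤n+m _ (exponent s e))) next≤b) rich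

      ¬both : ∀ e {E} → next s e ≤ b → Dense e E → Arrow s c G E → Arrow s c G (swap₂₃ E) → ⊥
      ¬both e {E} next≤b = ¬two-arrows cov e E (next≤⇒h< e next≤b) (next≤⇒2+e≤ e next≤b)

      Rich-swap₁₃ : ∀ {f} E → Rich f E → Rich f (swap₁₃ E)
      Rich-swap₁₃ {f} E = subst (λ t → N * N * (B * B * B) ≤ m ^ f * t) (sym (C₄-swap₁₃ E))

      Dense-resp : ∀ {e} E F → total F ≡ total E → Dense e E → Dense e F
      Dense-resp {e} E F eq = subst (λ t → N * N * B ≤ m ^ e * t) (sym eq)

    private
      swap₁₂⊆ : ∀ {E : Rel₃ {n}} → E ⊆ G → swap₁₂ E ⊆ G
      swap₁₂⊆ E⊆G x y z e = sym₁₂ symG y x z (E⊆G y x z e)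

      swap₂₃⊆ : ∀ {E : Rel₃ {n}} → E ⊆ G → swap₂₃ E ⊆ G
      swap₂₃⊆ E⊆G x y z e = sym₂₃ symG x z y (E⊆G x z y e)

      swap₁₃⊆ : ∀ {E : Rel₃ {n}} → E ⊆ G → swap₁₃ E ⊆ G
      swap₁₃⊆ E⊆G x y z e = sym₁₂ symG y x z (sym₂₃ symG y z x (sym₁₂ symG z y x (E⊆G z y x e)))

      Bounded-swap₁₂ : ∀ {E : Rel₃ {n}} → Bounded B E → Bounded B (swap₁₂ E)
      Bounded-swap₁₂ bd = Bounded-swap₂₃ (Bounded-swap₁₃ (Bounded-swap₂₃ bd))

    -- Given x → y, rich links of the `z` would yield x → z on a dense subrelation, where x → y
    -- persists.
    ¬Rich₃ : ∀ e (E : Rel₃ {n}) → next s (next s e) ≤ b → E ⊆ G → Bounded B E → Arrow s c G E →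
             Rich (exponent s e) (swap₂₃ E) → ⊥
    ¬Rich₃ e E next²≤b E⊆G bd arrow rich =
      let F , F⊆ , denseF , arrowF =
            refine e (≤-trans (e≤next s _) next²≤b) (swap₂₃⊆ E⊆G) (Bounded-swap₂₃ bd) rich
      in ¬both (next s e) next²≤b denseF arrowF
           (Arrow-⊆ {s = s} {G = G} {E = swap₂₃ F} {F = E} (λ x y z → F⊆ x z y) arrow)

    -- `F` lists the roles as (z , x , y), so its arrow is z → x. Rich links of the `y`, read with
    -- `x` and `z` exchanged, would yield z → y beside it.
    ¬Rich₂ : ∀ e E F → next s (next s e) ≤ b → E ⊆ G → Bounded B E →
             (∀ x y z → T (E x y z) → T (F z x y)) → Arrow s c G F → Rich (exponent s e) E → ⊥
    ¬Rich₂ e E F next²≤b E⊆G bd E⊆F arrow rich =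
      let F′ , F′⊆ , denseF′ , arrowF′ =
            refine e (≤-trans (e≤next s _) next²≤b) (swap₁₃⊆ E⊆G) (Bounded-swap₁₃ bd)
                   (Rich-swap₁₃ {exponent s e} E rich)
      in ¬both (next s e) next²≤b denseF′ arrowF′
           (Arrow-⊆ {s = s} {G = G} {E = swap₂₃ F′} {F = F} (λ x y z e → E⊆F y z x (F′⊆ x z y e)) arrow)

    -- The first `next` pays for reaching z → x, the second for the arrow that conflicts with x → y
    -- or z → x, and the third for the comparison in `¬both`.
    ¬Arrow : ∀ e E → next s (next s (next s e)) ≤ b → E ⊆ G → Bounded B E → Dense e E → Arrow s c G E → ⊥
    ¬Arrow e E next³≤b E⊆G bd dense arrow =
      -- In the second case the roles are (y , z , x). Exchanging the outer two gives (x , z , y),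
      -- which is definitionally `swap₂₃ E`.
      [ from₁ , (λ rich₃ → ¬Rich₃ e E next²≤b E⊆G bd arrow
                  (Rich-swap₁₃ {exponent s e} (swap₂₃ (swap₁₂ E)) rich₃)) ]′
        (enrich e {swap₁₂ E} (≤-trans (e≤next s _) next²≤b) (swap₁₂⊆ E⊆G) (Bounded-swap₁₂ bd)
          (Dense-resp {e} E (swap₁₂ E) (total-swap₁₂ E) dense))
      where
      next²≤b = ≤-trans (e≤next s _) next³≤b
      from₁ : Rich (exponent s e) (swap₁₂ E) → ⊥
      from₁ rich₁ =
        let F , F⊆ , denseF , arrowF =
              refine e (≤-trans (e≤next s _) next²≤b) (swap₁₃⊆ (swap₁₂⊆ E⊆G)) (Bounded-swap₁₃ (Bounded-swap₁₂ bd))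
                     (Rich-swap₁₃ {exponent s e} (swap₁₂ E) rich₁)
            -- `F` has the roles (z , x , y). Put back into the order (x , y , z) it is a
            -- subrelation of `E`, on which x → y holds beside z → x.
            E′ = swap₁₃ (swap₂₃ F)
            E′⊆E : E′ ⊆ E
            E′⊆E = λ x y z → F⊆ z x y
            E′⊆G : E′ ⊆ G
            E′⊆G = λ x y z e → E⊆G x y z (E′⊆E x y z e)
            bd′ = Bounded-⊆ E′⊆E bd
        in [ ¬Rich₂ (next s e) E′ F next³≤b E′⊆G bd′ (λ x y z e → e) arrowF
           , ¬Rich₃ (next s e) E′ next³≤b E′⊆G bd′
               (Arrow-⊆ {s = s} {G = G} {E = E′} {F = E} E′⊆E arrow) ]′
             (enrich (next s e) {E′} next²≤b E′⊆G bd′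
               (Dense-resp {next s e} F E′ (trans (total-swap₁₃ (swap₂₃ F)) (total-swap₂₃ F)) denseF))

    -- Giving the name y to the role whose links are rich produces the first arrow x → y, at the
    -- cost of a fourth `next`.
    ¬Dense : ∀ e E → next s (next s (next s (next s e))) ≤ b → E ⊆ G → Bounded B E → Dense e E → ⊥
    ¬Dense e E next⁴≤b E⊆G bd dense =
      [ continue E⊆G bd , continue (swap₂₃⊆ E⊆G) (Bounded-swap₂₃ bd) ]′ (enrich e next≤b E⊆G bd dense)
      where
      next≤b : next s e ≤ b
      next≤b = ≤-trans (e≤next s _) (≤-trans (e≤next s _) (≤-trans (e≤next s _) next⁴≤b))
      continue : ∀ {E : Rel₃ {n}} → E ⊆ G → Bounded B E → Rich (exponent s e) E → ⊥
      continue E⊆G bd rich =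
        let F , F⊆E , denseF , arrow = refine e next≤b E⊆G bd rich
        in ¬Arrow (next s e) F next⁴≤b (λ x y z e → E⊆G x y z (F⊆E x y z e)) (Bounded-⊆ F⊆E bd) denseF arrow

-- Bounding the codegrees

-- Going down from `K`, each step without a jump loses at most a factor 4, and `a 0 ≡ 0` forces a
-- jump. Applied to the sizes of the levels, it finds a scale of codegrees at which most edges are
-- new.
last-jump : ∀ (a : ℕ → ℕ) K → a 0 ≡ 0 → 0 <ⁿ a K → ∃ λ j → a K ≤ 4 ^ K * a (suc j) × 4 * a j <ⁿ a (suc j)
last-jump a zero    a0≡0 0<a0 = ⊥-elim (<⇒≢ 0<a0 (sym a0≡0))
last-jump a (suc K) a0≡0 0<a with 4 * a K <? a (suc K)
... | yes jump = K , m≤n*m (a (suc K)) (4 ^ suc K) {{m^n≢0 4 (suc K)}} , jump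
... | no ¬jump with last-jump a K a0≡0 (n≢0⇒n>0 λ aK≡0 → <⇒≱ 0<a (≤-trans (≮⇒≥ ¬jump) (≤-reflexive (cong (4 *_) aK≡0))))
...   | j , aK≤ , jump = j , ≤-trans (≮⇒≥ ¬jump) (≤-trans (*-monoʳ-≤ 4 aK≤) (≤-reflexive (sym (*-assoc 4 (4 ^ K) _)))) , jump

ι≤ : ∀ {b k} → (T b → 1 ≤ k) → ι b ≤ k
ι≤ {false} _ = z≤n
ι≤ {true}  h = h tt

module _ {n : ℕ} where

  private
    vs = allFin n

  total-mono : ∀ {E F : Rel₃} → E ⊆ F → total E ≤ total F
  total-mono E⊆F = ∑-mono vs λ y → ∑-mono vs λ z → ∑-mono vs λ x → ι-mono (E⊆F x y z)

  module Levels (G : Rel₃ {n}) (symG : Symmetric G) (m : ℕ) .{{_ : NonZero m}} where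

    pairDegree : Fin n → Fin n → ℕ
    pairDegree y z = ∑[ x ∈ vs ] ι (G x y z)

    pairDegree-sym : ∀ y z → pairDegree y z ≡ pairDegree z y
    pairDegree-sym y z = ≤-antisym (∑-mono vs λ x → ι-mono (sym₂₃ symG x y z)) (∑-mono vs λ x → ι-mono (sym₂₃ symG x z y))

    small : ℕ → Fin n → Fin n → Bool
    small j y z = pairDegree y z <ᵇ m ^ j

    big : ℕ → Fin n → Fin n → Bool
    big j y z = m ^ j ≤ᵇ pairDegree y z

    small⊎big : ∀ j y z → T (small j y z) ⊎ T (big j y z)
    small⊎big j y z with pairDegree y z <? m ^ j
    ... | yes lt = inj₁ (<⇒<ᵇ lt)
    ... | no ¬lt = inj₂ (≤⇒≤ᵇ (≮⇒≥ ¬lt))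

    small-sym : ∀ j y z → T (small j y z) → T (small j z y)
    small-sym j y z = subst (λ d → T (d <ᵇ m ^ j)) (pairDegree-sym y z)

    big-sym : ∀ j y z → T (big j y z) → T (big j z y)
    big-sym j y z = subst (λ d → T (m ^ j ≤ᵇ d)) (pairDegree-sym y z)

    -- All three pairs are tested, with codegrees in `G` rather than in the level itself. Levels are
    -- thus symmetric and bounded without any iterated deletion.
    level : ℕ → Rel₃
    level j x y z = G x y z ∧ small j y z ∧ small j x z ∧ small j x y

    record InLevel (j : ℕ) (x y z : Fin n) : Set where
      constructor inLevel
      field
        edge    : T (G x y z)
        small₂₃ : T (small j y z)
        small₁₃ : T (small j x z)
        small₁₂ : T (small j x y)

    open InLevel

    T-level⁻ : ∀ j x y z → T (level j x y z) → InLevel j x y z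
    T-level⁻ j x y z t =
      let g , t₁ = Equivalence.to (T-∧ {G x y z}) t
          s₁ , t₂ = Equivalence.to (T-∧ {small j y z}) t₁
          s₂ , s₃ = Equivalence.to (T-∧ {small j x z}) t₂
      in inLevel g s₁ s₂ s₃

    T-level⁺ : ∀ j x y z → InLevel j x y z → T (level j x y z)
    T-level⁺ j x y z (inLevel g s₁ s₂ s₃) = Equivalence.from (T-∧ {G x y z})
      (g , Equivalence.from (T-∧ {small j y z}) (s₁ , Equivalence.from (T-∧ {small j x z}) (s₂ , s₃)))

    level⊆G : ∀ j → level j ⊆ G
    level⊆G j x y z t = edge (T-level⁻ j x y z t)

    level-sym : ∀ j → Symmetric (level j)
    level-sym j = record
      { sym₁₂ = λ x y z t → let inLevel g a b c = T-level⁻ j x y z t in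
                  T-level⁺ j y x z (inLevel (sym₁₂ symG x y z g) b a (small-sym j x y c))
      ; sym₂₃ = λ x y z t → let inLevel g a b c = T-level⁻ j x y z t in
                  T-level⁺ j x z y (inLevel (sym₂₃ symG x y z g) (small-sym j y z a) c b)
      }

    level-Bounded : ∀ j → Bounded (m ^ j) (level j)
    level-Bounded j = record
      { codegree₁ = codegree₁′
      ; codegree₂ = λ x z → ≤-trans (∑-mono vs λ y → ι-mono (sym₁₂ (level-sym j) x y z)) (codegree₁′ x z)
      ; codegree₃ = λ x y → ≤-trans (∑-mono vs λ z → ι-mono λ t → sym₁₂ (level-sym j) x z y (sym₂₃ (level-sym j) x y z t)) (codegree₁′ x y)
      }
      where
      codegree₁′ : ∀ y z → (∑[ x ∈ vs ] ι (level j x y z)) ≤ m ^ j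
      codegree₁′ y z with small j y z in eq
      ... | true  = ≤-trans (∑-mono vs λ x → ι-mono {G x y z ∧ small j x z ∧ small j x y} {G x y z}
                      λ t → proj₁ (Equivalence.to (T-∧ {G x y z}) t))
                      (<⇒≤ (<ᵇ⇒< _ _ (subst T (sym eq) tt)))
      ... | false = ≤-trans (≤-reflexive (∑-zero vs λ x → none (G x y z))) z≤n
        where
        none : ∀ b → ι (b ∧ false) ≡ 0
        none true  = refl
        none false = refl

    -- An edge gives its own pairs codegree at least 1, which is `m ^ 0`.
    total-level-0 : total (level 0) ≡ 0
    total-level-0 = ∑-zero vs λ y → ∑-zero vs λ z → ∑-zero vs λ x → none x y z
      where
      none : ∀ x y z → ι (level 0 x y z) ≡ 0
      none x y z with level 0 x y z in eq
      ... | false = refl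
      ... | true  = let inLevel g s₁ _ _ = T-level⁻ 0 x y z (subst T (sym eq) tt) in
        ⊥-elim (<⇒≱ (<ᵇ⇒< (pairDegree y z) 1 s₁)
          (≤-trans (≤-reflexive (sym (T⇒ι≡1 g))) (∑-∈ (λ x → ι (G x y z)) (∈-vs x))))

    G⊆level : ∀ j → n <ⁿ m ^ j → G ⊆ level j
    G⊆level j n<m^j x y z g = T-level⁺ j x y z (inLevel g (all y z) (all x z) (all x y))
      where
      all : ∀ y z → T (small j y z)
      all y z = <⇒<ᵇ (≤-<-trans (≤-trans (∑-vs-bound ≤-refl λ x → ι≤1 (G x y z)) (≤-reflexive (*-identityʳ n))) n<m^j)

    -- Fixing the place of the heavy pair as `y` , `z` lets `∑-big` bound the number of pairs that
    -- carry these edges.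
    top : ℕ → Rel₃
    top j x y z = level (suc j) x y z ∧ big j y z

    top⊆level : ∀ j → top j ⊆ level (suc j)
    top⊆level j x y z t = proj₁ (Equivalence.to (T-∧ {level (suc j) x y z}) t)

    -- An edge outside the lower level has a heavy pair. By symmetry of the upper level, exchanging
    -- roles moves that pair to the places `y` , `z`; its three possible places give the factor 3.
    level≤ : ∀ j → total (level (suc j)) ≤ total (level j) + 3 * total (top j)
    level≤ j = begin
      total (level (suc j))
        ≤⟨ ∑-mono vs (λ y → ∑-mono vs λ z → ∑-mono vs λ x → pointwise x y z) ⟩
      (∑[ y ∈ vs ] ∑[ z ∈ vs ] ∑[ x ∈ vs ] (ι (level j x y z) + (ι (top j x y z) + (ι (swap₁₂ (top j) x y z) + ι (swap₁₃ (top j) x y z)))))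
        ≡⟨ total-+ (λ x y z → ι (level j x y z)) _ ⟩
      total (level j) + _
        ≡⟨ cong (λ u → total (level j) + u) (trans (total-+ (λ x y z → ι (top j x y z)) _)
             (cong (λ u → total (top j) + u) (trans (total-+ (λ x y z → ι (swap₁₂ (top j) x y z)) (λ x y z → ι (swap₁₃ (top j) x y z)))
               (cong₂ _+_ (total-swap₁₂ (top j)) (trans (total-swap₁₃ (top j)) (sym (+-identityʳ _))))))) ⟩
      total (level j) + 3 * total (top j) ∎
      where
      open ≤-Reasoning
      total-+ : ∀ (f g : Fin n → Fin n → Fin n → ℕ) →
        (∑[ y ∈ vs ] ∑[ z ∈ vs ] ∑[ x ∈ vs ] (f x y z + g x y z)) ≡
        (∑[ y ∈ vs ] ∑[ z ∈ vs ] ∑[ x ∈ vs ] f x y z) + (∑[ y ∈ vs ] ∑[ z ∈ vs ] ∑[ x ∈ vs ] g x y z)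
      total-+ f g = trans (∑-cong vs λ y → trans (∑-cong vs λ z → ∑-+ vs (λ x → f x y z) (λ x → g x y z))
        (∑-+ vs _ _)) (∑-+ vs _ _)
      top⁺ : ∀ x y z → T (level (suc j) x y z) → T (big j y z) → T (top j x y z)
      top⁺ x y z l b = Equivalence.from (T-∧ {level (suc j) x y z}) (l , b)
      1≤ : ∀ {b} → T b → 1 ≤ ι b
      1≤ t = ≤-reflexive (sym (T⇒ι≡1 t))
      pointwise : ∀ x y z → ι (level (suc j) x y z) ≤
        ι (level j x y z) + (ι (top j x y z) + (ι (swap₁₂ (top j) x y z) + ι (swap₁₃ (top j) x y z)))
      pointwise x y z = ι≤ {level (suc j) x y z} λ t → cover x y z t (small⊎big j y z) (small⊎big j x z) (small⊎big j x y)
        where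
        cover : ∀ x y z → T (level (suc j) x y z) → T (small j y z) ⊎ T (big j y z) →
                T (small j x z) ⊎ T (big j x z) → T (small j x y) ⊎ T (big j x y) → 1 ≤
                ι (level j x y z) + (ι (top j x y z) + (ι (swap₁₂ (top j) x y z) + ι (swap₁₃ (top j) x y z)))
        cover x y z t (inj₂ b) _ _ = ≤-trans (1≤ (top⁺ x y z t b))
          (≤-trans (m≤m+n (ι (top j x y z)) _) (m≤n+m _ (ι (level j x y z))))
        cover x y z t (inj₁ _) (inj₂ b) _ = ≤-trans (1≤ (top⁺ y x z (sym₁₂ (level-sym (suc j)) x y z t) b))
          (≤-trans (m≤m+n (ι (top j y x z)) _) (≤-trans (m≤n+m _ (ι (top j x y z))) (m≤n+m _ (ι (level j x y z)))))
        cover x y z t (inj₁ _) (inj₁ _) (inj₂ b) = ≤-trans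
          (1≤ (top⁺ z y x (sym₂₃ (level-sym (suc j)) z x y (sym₁₂ (level-sym (suc j)) x z y (sym₂₃ (level-sym (suc j)) x y z t)))
                (big-sym j x y b)))
          (≤-trans (m≤n+m _ (ι (top j y x z))) (≤-trans (m≤n+m _ (ι (top j x y z))) (m≤n+m _ (ι (level j x y z)))))
        cover x y z t (inj₁ s₁) (inj₁ s₂) (inj₁ s₃) = ≤-trans
          (1≤ (T-level⁺ j x y z (inLevel (edge (T-level⁻ (suc j) x y z t)) s₁ s₂ s₃)))
          (m≤m+n (ι (level j x y z)) _)

    top-large : ∀ j → 4 * total (level j) <ⁿ total (level (suc j)) → total (level (suc j)) ≤ 4 * total (top j)
    top-large j jump = *-cancelˡ-≤ 3 (+-cancelˡ-≤ L _ _ (begin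
      L + 3 * L                                          ≤⟨ *-monoʳ-≤ 4 (level≤ j) ⟩
      4 * (total (level j) + 3 * total (top j))          ≡⟨ *-distribˡ-+ 4 (total (level j)) _ ⟩
      4 * total (level j) + 4 * (3 * total (top j))      ≤⟨ +-monoˡ-≤ _ (<⇒≤ jump) ⟩
      L + 4 * (3 * total (top j))                        ≡⟨ cong (λ u → L + u) (lemma (total (top j))) ⟩
      L + 3 * (4 * total (top j))                        ∎))
      where
      open ≤-Reasoning
      L = total (level (suc j))
      lemma : ∀ t → 4 * (3 * t) ≡ 3 * (4 * t)
      lemma = solve-∀

    ∑-big : ∀ j → m ^ j * (∑[ y ∈ vs ] ∑[ z ∈ vs ] ι (big j y z)) ≤ total G
    ∑-big j = begin
      m ^ j * (∑[ y ∈ vs ] ∑[ z ∈ vs ] ι (big j y z))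
        ≡⟨ trans (∑-cong vs λ y → ∑-*ˡ vs (m ^ j) λ z → ι (big j y z)) (∑-*ˡ vs (m ^ j) λ y → ∑[ z ∈ vs ] ι (big j y z)) ⟨
      (∑[ y ∈ vs ] ∑[ z ∈ vs ] m ^ j * ι (big j y z))
        ≤⟨ ∑-mono vs (λ y → ∑-mono vs λ z → pointwise y z) ⟩
      total G ∎
      where
      open ≤-Reasoning
      pointwise : ∀ y z → m ^ j * ι (big j y z) ≤ pairDegree y z
      pointwise y z with big j y z in eq
      ... | false = ≤-trans (≤-reflexive (*-zeroʳ (m ^ j))) z≤n
      ... | true  = ≤-trans (≤-reflexive (*-identityʳ (m ^ j))) (≤ᵇ⇒≤ _ _ (subst T (sym eq) tt))

    stars-top : ∀ {k c N} → Covering (suc k) c G → n ≤ N → ∀ j →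
                stars (suc k) (top j) ≤ 2 * (N ^ suc k * (c * m ^ suc j))
    stars-top {k} {c} {N} cov n≤N j = begin
      stars (suc k) (top j)
        ≤⟨ stars≤centred cov (top j) (λ x y z t → level⊆G (suc j) x y z (top⊆level j x y z t)) ⟩
      centred cov (top j) + centred cov (swap₂₃ (top j))
        ≤⟨ +-mono-≤ (centred≤ cov (top j) n≤N (degree≤ bd)) (centred≤ cov (swap₂₃ (top j)) n≤N (degree≤ (Bounded-swap₂₃ bd))) ⟩
      M + M
        ≡⟨ cong (λ u → M + u) (+-identityʳ M) ⟨
      2 * M ∎
      where
      open ≤-Reasoning
      M = N ^ suc k * (c * m ^ suc j)
      bd : Bounded (m ^ suc j) (top j)
      bd = Bounded-⊆ (top⊆level j) (level-Bounded (suc j))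
      degree≤ : ∀ {B E} → Bounded B E → ∀ y (X : Vec (Fin n) (suc k)) → degree E y X ≤ B
      degree≤ {E = E} bd y (x ∷ X) = ≤-trans
        (∑-mono vs λ z → ≤-trans (*-monoʳ-≤ (ι (E x y z)) (Π≤1 (λ x → E x y z) X)) (≤-reflexive (*-identityʳ _)))
        (codegree₃ bd x y)

-- With N = m ^ q, the bound B = m ^ b on codegrees is N ^ (1 - 1 / (s - 1)) up to
-- a constant power of m.
module Parameters (r′ κ : ℕ) where

  r s q b : ℕ
  r = 1 + r′
  s = 2 + r
  q = κ * (1 + r)
  -- The slack 9 serves the comparison of exponents that ends `last-level<b`. As `total-bound`
  -- divides by `m ^ 10`, one factor of `m` is saved over N^(3 - 1/(s-1)).
  b = κ * r + 9

  N^s*B≤N²*B^s : ∀ m .{{_ : NonZero m}} → (m ^ q) ^ s * m ^ b ≤ m ^ q * m ^ q * (m ^ b) ^ s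
  N^s*B≤N²*B^s m = begin
    (m ^ q) ^ s * m ^ b                ≡⟨ cong (_* m ^ b) (^-*-assoc m q s) ⟩
    m ^ (q * s) * m ^ b                ≡⟨ ^-distribˡ-+-* m (q * s) b ⟨
    m ^ (q * s + b)                    ≤⟨ ^-monoʳ-≤ m (≤-trans (m≤m+n _ (9 * r + 9)) (≤-reflexive (exponents κ r))) ⟩
    m ^ (q + q + b * s)                ≡⟨ ^-distribˡ-+-* m (q + q) (b * s) ⟩
    m ^ (q + q) * m ^ (b * s)          ≡⟨ cong₂ _*_ (^-distribˡ-+-* m q q) (sym (^-*-assoc m b s)) ⟩
    m ^ q * m ^ q * (m ^ b) ^ s        ∎
    where
    open ≤-Reasoning
    exponents : ∀ κ r → κ * (1 + r) * (2 + r) + (κ * r + 9) + (9 * r + 9) ≡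
                        κ * (1 + r) + κ * (1 + r) + (κ * r + 9) * (2 + r)
    exponents = solve-∀

  module _ (m c : ℕ) .{{_ : NonZero m}} (2≤m : 2 ≤ m)
           (4^K≤m : 2 * 4 ^ (2 + q) ≤ m) (2^sc≤m : 2 ^ (2 + s) * c ≤ m) (2s≤m : 2 * s ≤ m)
           {n : ℕ} (n≤N : n ≤ m ^ q) (G : Rel₃ {n}) (symG : Symmetric G) (cov : Covering s c G) where

    open Levels G symG m

    private
      vs = allFin n
      N = m ^ q
      k = 1 + r

    -- The edges of `top j` lie over at most `total G` / m^j pairs, hence have codegrees of about
    -- m^j there on average, and `stars-≥` gives about `total G` times m^(j (s-1)) stars.
    -- `stars-top` allows only about N^s m^j. For `j` at least `b` these contradict each other.
    last-level<b : m ^ (q + q + b) ≤ m ^ 10 * total G → ∀ j → total G ≤ 4 ^ (1 + q) * total (level (suc j)) →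
                   4 * total (level j) <ⁿ total (level (suc j)) → j <ⁿ b
    last-level<b big-G j G≤ jump = ≰⇒> absurd
      where
      open ≤-Reasoning
      X = total (top j)
      G≤X : total G ≤ 4 ^ (2 + q) * X
      G≤X = begin
        total G                                      ≤⟨ G≤ ⟩
        4 ^ (1 + q) * total (level (suc j))          ≤⟨ *-monoʳ-≤ (4 ^ (1 + q)) (top-large j jump) ⟩
        4 ^ (1 + q) * (4 * X)                        ≡⟨ lemma (4 ^ (1 + q)) X ⟩
        4 ^ (2 + q) * X                              ∎
        where
        lemma : ∀ p x → p * (4 * x) ≡ 4 * p * x
        lemma = solve-∀
      4^≤m : 4 ^ (2 + q) ≤ m
      4^≤m = ≤-trans (m≤n*m (4 ^ (2 + q)) 2) 4^K≤m
      T′ = stars s (top j)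
      module _ (i : ℕ) (j≡ : j ≡ 3 + i) where
        -- Two factors of `m` below `m ^ j`, as room for constants. The exponent is positive, so
        -- that `2 * s ≤ μ`.
        μ = m ^ (1 + i)
        S = ∑[ y ∈ vs ] ∑[ z ∈ vs ] ι (big j y z)
        2μS≤X : 2 * μ * S ≤ X
        2μS≤X = *-cancelˡ-≤ m (begin
          m * (2 * μ * S)                ≡⟨ lemma₁ m μ S ⟩
          2 * (m * μ * S)                ≤⟨ *-monoʳ-≤ 2 (*-monoˡ-≤ S (m≤n*m (m * μ) m)) ⟩
          2 * (m * (m * μ) * S)          ≡⟨ cong (λ e → 2 * (m ^ e * S)) j≡ ⟨
          2 * (m ^ j * S)                ≤⟨ *-monoʳ-≤ 2 (≤-trans (∑-big j) G≤X) ⟩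
          2 * (4 ^ (2 + q) * X)          ≡⟨ *-assoc 2 (4 ^ (2 + q)) X ⟨
          2 * 4 ^ (2 + q) * X            ≤⟨ *-monoˡ-≤ X 4^K≤m ⟩
          m * X                          ∎)
          where
          lemma₁ : ∀ m μ S → m * (2 * μ * S) ≡ 2 * (m * μ * S)
          lemma₁ = solve-∀
        Xμ^k≤ : X * μ ^ k ≤ 2 * (2 ^ s * T′)
        Xμ^k≤ = +-cancelˡ-≤ (X * μ ^ k) _ _ (begin
          X * μ ^ k + X * μ ^ k                  ≡⟨ cong (λ u → X * μ ^ k + u) (+-identityʳ (X * μ ^ k)) ⟨
          2 * (X * μ ^ k)                        ≤⟨ *-monoʳ-≤ 2 (stars-≥ k (top j) μ (λ y z → ι (big j y z))
                                                      (≤-trans 2s≤m (m≤m*n m (m ^ i) {{m^n≢0 m i}})) supp) ⟩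
          2 * (μ ^ s * S + 2 ^ s * T′)           ≡⟨ lemma₂ μ (μ ^ k) S (2 ^ s * T′) ⟩
          2 * μ * S * μ ^ k + 2 * (2 ^ s * T′)   ≤⟨ +-monoˡ-≤ (2 * (2 ^ s * T′)) (*-monoˡ-≤ (μ ^ k) 2μS≤X) ⟩
          X * μ ^ k + 2 * (2 ^ s * T′)           ∎)
          where
          lemma₂ : ∀ μ p S t → 2 * (μ * p * S + t) ≡ 2 * μ * S * p + 2 * t
          lemma₂ = solve-∀
          supp : ∀ x y z → T (top j x y z) → 1 ≤ ι (big j y z)
          supp x y z t = ≤-reflexive (sym (T⇒ι≡1 (proj₂ (Equivalence.to (T-∧ {level (suc j) x y z}) t))))
        -- The summand 13 is 10 from `big-G`, 1 for the powers of 4, 1 for the factor with `c`, and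
        -- 1 from `suc j`.
        upper : m ^ (q + q + b + (1 + i) * k) ≤ m ^ (13 + j + q * s)
        upper = begin
          m ^ (q + q + b + (1 + i) * k)                ≡⟨ trans (^-distribˡ-+-* m (q + q + b) ((1 + i) * k)) (cong (m ^ (q + q + b) *_) (sym (^-*-assoc m (1 + i) k))) ⟩
          m ^ (q + q + b) * μ ^ k                      ≤⟨ *-monoˡ-≤ (μ ^ k) (≤-trans big-G (*-monoʳ-≤ (m ^ 10) (≤-trans G≤X (*-monoˡ-≤ X 4^≤m)))) ⟩
          m ^ 10 * (m * X) * μ ^ k                     ≡⟨ lemma₃ (m ^ 10) m X (μ ^ k) ⟩
          m * m ^ 10 * (X * μ ^ k)                     ≤⟨ *-monoʳ-≤ (m * m ^ 10) (≤-trans Xμ^k≤ (*-monoʳ-≤ 2 (*-monoʳ-≤ (2 ^ s) (stars-top cov n≤N j)))) ⟩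
          m ^ 11 * (2 * (2 ^ s * (2 * (N ^ s * (c * m ^ suc j)))))  ≡⟨ lemma₄ (m ^ 11) (2 ^ s) (N ^ s) c (m ^ suc j) ⟩
          2 ^ (2 + s) * c * (m ^ 11 * (m ^ suc j * N ^ s))          ≤⟨ *-monoˡ-≤ (m ^ 11 * (m ^ suc j * N ^ s)) 2^sc≤m ⟩
          m * (m ^ 11 * (m ^ suc j * N ^ s))           ≡⟨ *-assoc m (m ^ 11) (m ^ suc j * N ^ s) ⟨
          m ^ 12 * (m ^ suc j * N ^ s)                 ≡⟨ cong (λ e → m ^ 12 * (m ^ suc j * e)) (^-*-assoc m q s) ⟩
          m ^ 12 * (m ^ suc j * m ^ (q * s))           ≡⟨ cong (m ^ 12 *_) (^-distribˡ-+-* m (suc j) (q * s)) ⟨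
          m ^ 12 * m ^ (suc j + q * s)                 ≡⟨ ^-distribˡ-+-* m 12 (suc j + q * s) ⟨
          m ^ (12 + (suc j + q * s))                   ≡⟨ cong (m ^_) (lemma₅ j (q * s)) ⟩
          m ^ (13 + j + q * s)                         ∎
          where
          lemma₃ : ∀ a m x p → a * (m * x) * p ≡ m * a * (x * p)
          lemma₃ = solve-∀
          lemma₄ : ∀ a p n c d → a * (2 * (p * (2 * (n * (c * d))))) ≡ 2 * (2 * p) * c * (a * (d * n))
          lemma₄ = solve-∀
          lemma₅ : ∀ j a → 12 + (suc j + a) ≡ 13 + j + a
          lemma₅ = solve-∀
      absurd : b ≤ j → ⊥
      absurd b≤j with m≤n⇒∃[o]m+o≡n b≤j
      ... | o , refl = <⇒≱ (^-monoʳ-< m 2≤m (≤-trans (m≤m+n (suc (13 + j + q * s)) (7 * r′ + o + o * r′))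
                         (≤-reflexive (exponents κ r′ o)))) (upper (κ * r + 6 + o) (offset (κ * r) o))
        where
        offset : ∀ a o → a + 9 + o ≡ 3 + (a + 6 + o)
        offset = solve-∀
        exponents : ∀ κ r′ o → suc (13 + (κ * (1 + r′) + 9 + o) + κ * (2 + r′) * (3 + r′)) + (7 * r′ + o + o * r′) ≡
          κ * (2 + r′) + κ * (2 + r′) + (κ * (1 + r′) + 9) + (1 + (κ * (1 + r′) + 6 + o)) * (2 + r′)
        exponents = solve-∀

-- κ is chosen so large that b exceeds all losses in the argument.
module _ (r′ : ℕ) where

  private
    κ₀ : ℕ
    κ₀ = next (3 + r′) (next (3 + r′) (next (3 + r′) (next (3 + r′) 11)))

  κ : ℕ
  κ = suc κ₀

  module _ (c : ℕ) .{{_ : NonZero c}} where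

    open Parameters r′ κ

    threshold : ℕ
    threshold = 2 * 4 ^ (2 + q) + (2 ^ (2 + s) * c + (2 * s + (4 * c + (suc (c * c) + (c ^ s + (4 + suc (2 ^ s)))))))

    threshold-nonZero : NonZero threshold
    threshold-nonZero = >-nonZero (≤-trans (m^n>0 4 (2 + q)) (≤-trans (m≤n*m (4 ^ (2 + q)) 2) (m≤m+n _ _)))

    -- Otherwise the level found by `last-jump` is nearly as large as `G`: 10 factors of `m` are
    -- lost by assumption and one more to `4 ^ (1 + q)`, hence `Dense 11`. Its codegrees are at most
    -- `m ^ b` by `last-level<b`, which contradicts `¬Dense`.
    total-bound : ∀ m → threshold ≤ m → ∀ {n} → n ≤ m ^ q → (G : Rel₃ {n}) → Symmetric G → Covering s c G →
                  m ^ 10 * total G ≤ m ^ (q + q + b)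
    total-bound m M≤m {n} n≤N G symG cov = ≮⇒≥ absurd
      where
      open ≤-Reasoning
      M₁ : 2 ^ (2 + s) * c + (2 * s + (4 * c + (suc (c * c) + (c ^ s + (4 + suc (2 ^ s)))))) ≤ m
      M₁ = m+n≤o⇒n≤o (2 * 4 ^ (2 + q)) M≤m
      M₂ : 2 * s + (4 * c + (suc (c * c) + (c ^ s + (4 + suc (2 ^ s))))) ≤ m
      M₂ = m+n≤o⇒n≤o (2 ^ (2 + s) * c) M₁
      M₃ : 4 * c + (suc (c * c) + (c ^ s + (4 + suc (2 ^ s)))) ≤ m
      M₃ = m+n≤o⇒n≤o (2 * s) M₂
      M₄ : suc (c * c) + (c ^ s + (4 + suc (2 ^ s))) ≤ m
      M₄ = m+n≤o⇒n≤o (4 * c) M₃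
      M₅ : c ^ s + (4 + suc (2 ^ s)) ≤ m
      M₅ = m+n≤o⇒n≤o (suc (c * c)) M₄
      M₆ : 4 + suc (2 ^ s) ≤ m
      M₆ = m+n≤o⇒n≤o (c ^ s) M₅
      4≤m : 4 ≤ m
      4≤m = m+n≤o⇒m≤o 4 M₆
      2≤m : 2 ≤ m
      2≤m = ≤-trans (s≤s (s≤s z≤n)) 4≤m
      instance
        m-nonZero : NonZero m
        m-nonZero = >-nonZero (<⇒≤ 2≤m)
        N-nonZero : NonZero (m ^ q)
        N-nonZero = m^n≢0 m q
      4^K≤m : 2 * 4 ^ (2 + q) ≤ m
      4^K≤m = m+n≤o⇒m≤o (2 * 4 ^ (2 + q)) M≤m
      open Levels G symG m
      absurd : ¬ (m ^ (q + q + b) <ⁿ m ^ 10 * total G)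
      absurd big-G with last-jump (λ j → total (level j)) (1 + q) total-level-0 positive
        where
        positive : 0 <ⁿ total (level (1 + q))
        positive = <-≤-trans (*-cancelˡ-< (m ^ 10) 0 (total G) (≤-<-trans (≤-reflexive (*-zeroʳ (m ^ 10))) (≤-<-trans z≤n big-G)))
          (total-mono (G⊆level (1 + q) (≤-<-trans n≤N (^-monoʳ-< m 2≤m (n<1+n q)))))
      ... | j , level≤ , jump = ¬Dense 11 (level (suc j)) κ≤b (level⊆G (suc j)) bd dense
        where
        G≤ : total G ≤ 4 ^ (1 + q) * total (level (suc j))
        G≤ = ≤-trans (total-mono (G⊆level (1 + q) (≤-<-trans n≤N (^-monoʳ-< m 2≤m (n<1+n q))))) level≤
        j<b : j <ⁿ b
        j<b = last-level<b m c 2≤m 4^K≤m (m+n≤o⇒m≤o (2 ^ (2 + s) * c) M₁) (m+n≤o⇒m≤o (2 * s) M₂) n≤N G symG cov (<⇒≤ big-G) j G≤ jump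
        open Regime r c m (m ^ q) b n≤N (N^s*B≤N²*B^s m) 4≤m (m+n≤o⇒n≤o 4 M₆) (m+n≤o⇒m≤o (2 * s) M₂)
          (m+n≤o⇒m≤o (4 * c) M₃) (m+n≤o⇒m≤o (suc (c * c)) M₄) (m+n≤o⇒m≤o (c ^ s) M₅) {G}
        open Contradiction symG cov
        κ≤b : κ₀ ≤ b
        κ≤b = ≤-trans (n≤1+n κ₀) (≤-trans (m≤m*n κ r) (m≤m+n (κ * r) 9))
        bd : Bounded (m ^ b) (level (suc j))
        bd = let bd′ = level-Bounded (suc j) ; m^j≤m^b = ^-monoʳ-≤ m j<b in record
          { codegree₁ = λ y z → ≤-trans (codegree₁ bd′ y z) m^j≤m^b
          ; codegree₂ = λ x z → ≤-trans (codegree₂ bd′ x z) m^j≤m^b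
          ; codegree₃ = λ x y → ≤-trans (codegree₃ bd′ x y) m^j≤m^b }
        dense : Dense 11 (level (suc j))
        dense = begin
          m ^ q * m ^ q * m ^ b                                ≡⟨ trans (^-distribˡ-+-* m (q + q) b) (cong (_* m ^ b) (^-distribˡ-+-* m q q)) ⟨
          m ^ (q + q + b)                                      ≤⟨ <⇒≤ big-G ⟩
          m ^ 10 * total G                                     ≤⟨ *-monoʳ-≤ (m ^ 10) (≤-trans G≤ (*-monoˡ-≤ (total (level (suc j))) 4^≤m)) ⟩
          m ^ 10 * (m * total (level (suc j)))                 ≡⟨ lemma (m ^ 10) m (total (level (suc j))) ⟩
          m ^ 11 * total (level (suc j))                       ∎
          where
          lemma : ∀ a m t → a * (m * t) ≡ m * a * t
          lemma = solve-∀
          4^≤m : 4 ^ (1 + q) ≤ m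
          4^≤m = ≤-trans (m≤n*m (4 ^ (1 + q)) 4) (≤-trans (m≤n*m (4 ^ (2 + q)) 2) 4^K≤m)

-- From hypergraphs to ternary relations

∈-image⁻ : ∀ {v n} (f : Fin v → Fin n) (p : Subset v) {j} → j ∈ image f p → ∃ λ i → i ∈ p × f i ≡ j
∈-image⁻ f p {j} j∈ with any? (λ i → (i ∈? p) ×-dec (f i ≟ j))
                      | trans (sym (lookup∘tabulate (λ j → does (any? λ i → (i ∈? p) ×-dec (f i ≟ j))) j)) ([]=⇒lookup j∈)
... | yes w | _ = w
... | no  _ | ()

∈-image⁺ : ∀ {v n} (f : Fin v → Fin n) (p : Subset v) {i} → i ∈ p → f i ∈ image f p
∈-image⁺ f p {i} i∈p = lookup⇒[]= (f i) (image f p)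
  (trans (lookup∘tabulate _ (f i)) (dec-true (any? λ i′ → (i′ ∈? p) ×-dec (f i′ ≟ f i)) (i , i∈p , refl)))

image-∪ : ∀ {v n} (f : Fin v → Fin n) p q → image f (p ∪ q) ≡ image f p ∪ image f q
image-∪ f p q = ⊆-antisym to from
  where
  to : ∀ {j} → j ∈ image f (p ∪ q) → j ∈ image f p ∪ image f q
  to j∈ with ∈-image⁻ f (p ∪ q) j∈
  ... | i , i∈ , refl = x∈p∪q⁺ ([ inj₁ ∘ ∈-image⁺ f p , inj₂ ∘ ∈-image⁺ f q ]′ (x∈p∪q⁻ p q i∈))
  from : ∀ {j} → j ∈ image f p ∪ image f q → j ∈ image f (p ∪ q)
  from j∈ with x∈p∪q⁻ (image f p) (image f q) j∈
  ... | inj₁ j∈p = let i , i∈p , eq = ∈-image⁻ f p j∈p in subst (_∈ image f (p ∪ q)) eq (∈-image⁺ f (p ∪ q) (x∈p∪q⁺ (inj₁ i∈p)))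
  ... | inj₂ j∈q = let i , i∈q , eq = ∈-image⁻ f q j∈q in subst (_∈ image f (p ∪ q)) eq (∈-image⁺ f (p ∪ q) (x∈p∪q⁺ {p = p} (inj₂ i∈q)))

image-⁅⁆ : ∀ {v n} (f : Fin v → Fin n) i → image f ⁅ i ⁆ ≡ ⁅ f i ⁆
image-⁅⁆ f i = ⊆-antisym to from
  where
  to : ∀ {j} → j ∈ image f ⁅ i ⁆ → j ∈ ⁅ f i ⁆
  to j∈ with ∈-image⁻ f ⁅ i ⁆ j∈
  ... | i′ , i′∈ , refl rewrite x∈⁅y⁆⇒x≡y i i′∈ = x∈⁅x⁆ (f i)
  from : ∀ {j} → j ∈ ⁅ f i ⁆ → j ∈ image f ⁅ i ⁆
  from j∈ rewrite x∈⁅y⁆⇒x≡y (f i) j∈ = ∈-image⁺ f ⁅ i ⁆ (x∈⁅x⁆ i)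

triple : ∀ {n} → Fin n → Fin n → Fin n → Subset n
triple x y z = ⁅ x ⁆ ∪ (⁅ y ⁆ ∪ ⁅ z ⁆)

image-triple : ∀ {v n} (f : Fin v → Fin n) x y z → image f (triple x y z) ≡ triple (f x) (f y) (f z)
image-triple f x y z = trans (image-∪ f ⁅ x ⁆ _) (cong₂ _∪_ (image-⁅⁆ f x)
  (trans (image-∪ f ⁅ y ⁆ ⁅ z ⁆) (cong₂ _∪_ (image-⁅⁆ f y) (image-⁅⁆ f z))))

triple-swap₂₃ : ∀ {n} (x y z : Fin n) → triple x y z ≡ triple x z y
triple-swap₂₃ x y z = cong (⁅ x ⁆ ∪_) (∪-comm ⁅ y ⁆ ⁅ z ⁆)

triple-swap₁₂ : ∀ {n} (x y z : Fin n) → triple x y z ≡ triple y x z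
triple-swap₁₂ x y z = trans (sym (∪-assoc ⁅ x ⁆ ⁅ y ⁆ ⁅ z ⁆))
  (trans (cong (_∪ ⁅ z ⁆) (∪-comm ⁅ x ⁆ ⁅ y ⁆)) (∪-assoc ⁅ y ⁆ ⁅ x ⁆ ⁅ z ⁆))

∣⁅x⁆∪p∣≤ : ∀ {n} (x : Fin n) p → ∣ ⁅ x ⁆ ∪ p ∣ ≤ suc ∣ p ∣
∣⁅x⁆∪p∣≤ zero    (true  ∷ p) = s≤s (≤-trans (≤-reflexive (cong ∣_∣ (∪-identityˡ p))) (n≤1+n _))
∣⁅x⁆∪p∣≤ zero    (false ∷ p) = s≤s (≤-reflexive (cong ∣_∣ (∪-identityˡ p)))
∣⁅x⁆∪p∣≤ (suc x) (true  ∷ p) = s≤s (∣⁅x⁆∪p∣≤ x p)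
∣⁅x⁆∪p∣≤ (suc x) (false ∷ p) = ∣⁅x⁆∪p∣≤ x p

private
  pair<3 : ∀ {n} (x y : Fin n) → ∣ ⁅ x ⁆ ∪ ⁅ y ⁆ ∣ <ⁿ 3
  pair<3 x y = s≤s (≤-trans (∣⁅x⁆∪p∣≤ x ⁅ y ⁆) (s≤s (≤-reflexive (∣⁅x⁆∣≡1 y))))

triple-≢₂₃ : ∀ {n} {x y z : Fin n} → ∣ triple x y z ∣ ≡ 3 → y ≢ z
triple-≢₂₃ {x = x} {y} eq refl = <⇒≢ (pair<3 x y) (trans (cong (λ p → ∣ ⁅ x ⁆ ∪ p ∣) (sym (∪-idem ⁅ y ⁆))) eq)

triple-≢₁₂ : ∀ {n} {x y z : Fin n} → ∣ triple x y z ∣ ≡ 3 → x ≢ y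
triple-≢₁₂ {x = x} {z = z} eq refl = <⇒≢ (pair<3 x z)
  (trans (cong ∣_∣ (trans (cong (_∪ ⁅ z ⁆) (sym (∪-idem ⁅ x ⁆))) (∪-assoc ⁅ x ⁆ ⁅ x ⁆ ⁅ z ⁆))) eq)

remove : ∀ {n k} (p : Subset n) → ∣ p ∣ ≡ suc k → ∃₂ λ x q → p ≡ ⁅ x ⁆ ∪ q × ∣ q ∣ ≡ k
remove (true  ∷ p) eq = zero , false ∷ p , cong (true ∷_) (sym (∪-identityˡ p)) , suc-injective eq
remove (false ∷ p) eq with remove p eq
... | x , q , p≡ , ∣q∣≡ = suc x , false ∷ q , cong (false ∷_) p≡ , ∣q∣≡

size-3⇒triple : ∀ {n} (p : Subset n) → ∣ p ∣ ≡ 3 → ∃ λ x → ∃₂ λ y z → p ≡ triple x y z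
size-3⇒triple p eq with remove p eq
... | x , q , refl , ∣q∣≡2 with remove q ∣q∣≡2
... | y , q′ , refl , ∣q′∣≡1 with remove q′ ∣q′∣≡1
... | z , q″ , refl , ∣q″∣≡0 = x , y , z , cong (λ p → ⁅ x ⁆ ∪ (⁅ y ⁆ ∪ p)) (trans (cong (⁅ z ⁆ ∪_) (empty q″ ∣q″∣≡0)) (∪-identityʳ ⁅ z ⁆))
  where
  empty : ∀ {n} (p : Subset n) → ∣ p ∣ ≡ 0 → p ≡ ∅
  empty []          eq = refl
  empty (false ∷ p) eq = cong (false ∷_) (empty p eq)

length-filter-∑ : ∀ {A : Set} {P : A → Set} (P? : Decidable P) xs → length (filter P? xs) ≡ ∑[ x ∈ xs ] ι (does (P? x))
length-filter-∑ P? []       = refl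
length-filter-∑ P? (x ∷ xs) with does (P? x)
... | true  = cong suc (length-filter-∑ P? xs)
... | false = length-filter-∑ P? xs

∑-subsets-δ : ∀ {n} (p : Subset n) → (∑[ e ∈ subsets n ] ι (does (e ≟ˢ p))) ≤ 1
∑-subsets-δ []      = ≤-refl
∑-subsets-δ {suc n} (b ∷ p) = begin
  (∑[ e ∈ subsets (suc n) ] ι (does (e ≟ˢ (b ∷ p))))
    ≡⟨ trans (∑-++ (map (inside ∷_) (subsets n)) _ _) (cong₂ _+_ (∑-map (inside ∷_) (subsets n) _) (∑-map (outside ∷_) (subsets n) _)) ⟩
  (∑[ e ∈ subsets n ] ι (does ((inside ∷ e) ≟ˢ (b ∷ p)))) + (∑[ e ∈ subsets n ] ι (does ((outside ∷ e) ≟ˢ (b ∷ p))))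
    ≤⟨ split b ⟩
  (∑[ e ∈ subsets n ] ι (does (e ≟ˢ p)))
    ≤⟨ ∑-subsets-δ p ⟩
  1 ∎
  where
  open ≤-Reasoning
  split : ∀ b → (∑[ e ∈ subsets n ] ι (does ((inside ∷ e) ≟ˢ (b ∷ p)))) + (∑[ e ∈ subsets n ] ι (does ((outside ∷ e) ≟ˢ (b ∷ p))))
              ≤ ∑[ e ∈ subsets n ] ι (does (e ≟ˢ p))
  split true  = ≤-trans (+-mono-≤ ≤-refl (≤-reflexive (∑-zero (subsets n) λ _ → refl))) (≤-reflexive (+-identityʳ _))
  split false = ≤-trans (+-mono-≤ (≤-reflexive (∑-zero (subsets n) λ _ → refl)) ≤-refl) ≤-refl

module _ {n : ℕ} (H : Hypergraph 3 n) where

  private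
    vs = allFin n

  relation : Rel₃
  relation x y z = does (Edge? H (triple x y z))

  relation⇒Edge : ∀ {x y z} → T (relation x y z) → Edge H (triple x y z)
  relation⇒Edge {x} {y} {z} t with Edge? H (triple x y z)
  ... | yes e = e

  Edge⇒relation : ∀ {x y z} → Edge H (triple x y z) → T (relation x y z)
  Edge⇒relation {x} {y} {z} e = subst T (sym (dec-true (Edge? H (triple x y z)) e)) tt

  relation-sym : Symmetric relation
  relation-sym = record
    { sym₁₂ = λ x y z t → Edge⇒relation {y} {x} {z} (subst (Edge H) (triple-swap₁₂ x y z) (relation⇒Edge {x} {y} {z} t))
    ; sym₂₃ = λ x y z t → Edge⇒relation {x} {z} {y} (subst (Edge H) (triple-swap₂₃ x y z) (relation⇒Edge {x} {y} {z} t))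
    }

  -- Each edge is charged to one ordering of its vertices, and an ordered triple determines its
  -- edge.
  edgeCount≤total : edgeCount H ≤ total relation
  edgeCount≤total = begin
    edgeCount H
      ≡⟨ length-filter-∑ (Edge? H) (subsets n) ⟩
    (∑[ e ∈ subsets n ] ι (does (Edge? H e)))
      ≤⟨ ∑-mono (subsets n) pointwise ⟩
    (∑[ e ∈ subsets n ] ∑[ y ∈ vs ] ∑[ z ∈ vs ] ∑[ x ∈ vs ] w e x y z)
      ≡⟨ trans (∑-swap (subsets n) vs (λ e y → ∑[ z ∈ vs ] ∑[ x ∈ vs ] w e x y z)) (∑-cong vs λ y →
         trans (∑-swap (subsets n) vs (λ e z → ∑[ x ∈ vs ] w e x y z)) (∑-cong vs λ z →
         ∑-swap (subsets n) vs (λ e x → w e x y z))) ⟩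
    (∑[ y ∈ vs ] ∑[ z ∈ vs ] ∑[ x ∈ vs ] ∑[ e ∈ subsets n ] w e x y z)
      ≤⟨ ∑-mono vs (λ y → ∑-mono vs λ z → ∑-mono vs λ x → once x y z) ⟩
    total relation ∎
    where
    open ≤-Reasoning
    w : Subset n → Fin n → Fin n → Fin n → ℕ
    w e x y z = ι (relation x y z) * ι (does (e ≟ˢ triple x y z))
    once : ∀ x y z → (∑[ e ∈ subsets n ] w e x y z) ≤ ι (relation x y z)
    once x y z = ≤-trans (≤-reflexive (∑-*ˡ (subsets n) (ι (relation x y z)) _))
      (≤-trans (*-monoʳ-≤ (ι (relation x y z)) (∑-subsets-δ (triple x y z))) (≤-reflexive (*-identityʳ _)))
    pointwise : ∀ e → ι (does (Edge? H e)) ≤ ∑[ y ∈ vs ] ∑[ z ∈ vs ] ∑[ x ∈ vs ] w e x y z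
    pointwise e with Edge? H e
    ... | no  _ = z≤n
    ... | yes edge with size-3⇒triple e (uniform H edge)
    ... | x , y , z , refl = begin
      1                                                   ≡⟨ cong₂ _*_ (T⇒ι≡1 (Edge⇒relation {x} {y} {z} edge)) (cong ι (dec-true (triple x y z ≟ˢ triple x y z) refl)) ⟨
      w e x y z                                           ≤⟨ ∑-∈ (λ x → w e x y z) (∈-vs x) ⟩
      (∑[ x ∈ vs ] w e x y z)                             ≤⟨ ∑-∈ (λ z → ∑[ x ∈ vs ] w e x y z) (∈-vs z) ⟩
      (∑[ z ∈ vs ] ∑[ x ∈ vs ] w e x y z)                 ≤⟨ ∑-∈ (λ y → ∑[ z ∈ vs ] ∑[ x ∈ vs ] w e x y z) (∈-vs y) ⟩
      (∑[ y ∈ vs ] ∑[ z ∈ vs ] ∑[ x ∈ vs ] w e x y z)     ∎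

  distinct⇒injective : ∀ {k} (X : Vec (Fin n) k) → T (distinct X) → ∀ i j → lookup X i ≡ lookup X j → i ≡ j
  distinct⇒injective (x ∷ X) d i j eq = go i j eq
    where
    x∉X = ≡ᵇ⇒≡ (occurrences x X) 0 (proj₁ (Equivalence.to (T-∧ {occurrences x X ≡ᵇ 0}) d))
    dX = proj₂ (Equivalence.to (T-∧ {occurrences x X ≡ᵇ 0}) d)
    occurs : ∀ {k} (X : Vec (Fin n) k) j → occurrences (lookup X j) X ≢ 0
    occurs (y ∷ Y) zero    eq with y ≟ y | eq
    ... | yes _ | ()
    ... | no ¬p | _ = ¬p refl
    occurs (y ∷ Y) (suc j) eq = occurs Y j (m+n≡0⇒n≡0 (ι (does (lookup Y j ≟ y))) eq)
    go : ∀ i j → lookup (x ∷ X) i ≡ lookup (x ∷ X) j → i ≡ j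
    go zero    zero    eq = refl
    go zero    (suc j) eq = ⊥-elim (occurs X j (subst (λ v → occurrences v X ≡ 0) eq x∉X))
    go (suc i) zero    eq = ⊥-elim (occurs X i (subst (λ v → occurrences v X ≡ 0) (sym eq) x∉X))
    go (suc i) (suc j) eq = cong suc (distinct⇒injective X dX i j eq)

  -- Matchings and covers in the common graph of a tuple

  module _ {s : ℕ} (X : Vec (Fin n) (suc s)) where

    Joined : Fin n → Fin n → Set
    Joined y z = All (λ x → T (relation x y z)) X

    joined? : ∀ y z → Dec (Joined y z)
    joined? y z = All.all? (λ x → T? (relation x y z)) X

    -- `disjoint` concludes only that the two indices agree. That the ends of a single edge differ
    -- comes from uniformity, in `vertex-injective`.
    record Matching (j : ℕ) : Set where
      field
        vertex   : Fin j → Fin 2 → Fin n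
        joined   : ∀ i → Joined (vertex i zero) (vertex i (suc zero))
        disjoint : ∀ i a i′ a′ → vertex i a ≡ vertex i′ a′ → i ≡ i′

    open Matching

    covered? : ∀ {j} (M : Matching j) v → Dec (∃₂ λ i a → vertex M i a ≡ v)
    covered? M v = any? λ i → any? λ a → vertex M i a ≟ v

    covered : ∀ {j} → Matching j → Fin n → Bool
    covered M v = does (covered? M v)

    covered-size : ∀ {j} (M : Matching j) → (∑[ v ∈ vs ] ι (covered M v)) ≤ j * 2
    covered-size {j} M = begin
      (∑[ v ∈ vs ] ι (covered M v))
        ≤⟨ ∑-mono vs pointwise ⟩
      (∑[ v ∈ vs ] ∑[ i ∈ allFin j ] ∑[ a ∈ allFin 2 ] ι (does (v ≟ vertex M i a)))
        ≡⟨ trans (∑-swap vs (allFin j) (λ v i → ∑[ a ∈ allFin 2 ] ι (does (v ≟ vertex M i a))))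
             (∑-cong (allFin j) λ i → ∑-swap vs (allFin 2) (λ v a → ι (does (v ≟ vertex M i a)))) ⟩
      (∑[ i ∈ allFin j ] ∑[ a ∈ allFin 2 ] ∑[ v ∈ vs ] ι (does (v ≟ vertex M i a)))
        ≡⟨ ∑-cong (allFin j) (λ i → ∑-cong (allFin 2) λ a → ∑-allFin-δ (vertex M i a)) ⟩
      (∑[ i ∈ allFin j ] 2)
        ≤⟨ ∑-vs-bound {n = j} ≤-refl (λ i → ≤-refl) ⟩
      j * 2 ∎
      where
      open ≤-Reasoning
      pointwise : ∀ v → ι (covered M v) ≤ ∑[ i ∈ allFin j ] ∑[ a ∈ allFin 2 ] ι (does (v ≟ vertex M i a))
      pointwise v with covered? M v
      ... | no  _ = z≤n
      ... | yes (i , a , eq) = begin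
        1                                                                     ≡⟨ cong ι (dec-true (v ≟ vertex M i a) (sym eq)) ⟨
        ι (does (v ≟ vertex M i a))                                            ≤⟨ ∑-∈ (λ a → ι (does (v ≟ vertex M i a))) (∈-vs a) ⟩
        (∑[ a ∈ allFin 2 ] ι (does (v ≟ vertex M i a)))                        ≤⟨ ∑-∈ (λ i → ∑[ a ∈ allFin 2 ] ι (does (v ≟ vertex M i a))) (∈-vs i) ⟩
        (∑[ i ∈ allFin j ] ∑[ a ∈ allFin 2 ] ι (does (v ≟ vertex M i a)))      ∎

    extend : ∀ {j} (M : Matching j) {y z} → Joined y z →
             ¬ (∃₂ λ i a → vertex M i a ≡ y) → ¬ (∃₂ λ i a → vertex M i a ≡ z) → Matching (suc j)
    extend {j} M {y} {z} yz y∉M z∉M = record { vertex = vertex′ ; joined = joined′ ; disjoint = disjoint′ }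
      where
      new : Fin 2 → Fin n
      new zero    = y
      new (suc _) = z
      vertex′ : Fin (suc j) → Fin 2 → Fin n
      vertex′ zero    = new
      vertex′ (suc i) = vertex M i
      joined′ : ∀ i → Joined (vertex′ i zero) (vertex′ i (suc zero))
      joined′ zero    = yz
      joined′ (suc i) = joined M i
      new∉M : ∀ a i a′ → vertex M i a′ ≢ new a
      new∉M zero    i a′ eq = y∉M (i , a′ , eq)
      new∉M (suc _) i a′ eq = z∉M (i , a′ , eq)
      disjoint′ : ∀ i a i′ a′ → vertex′ i a ≡ vertex′ i′ a′ → i ≡ i′
      disjoint′ zero    a zero     a′ eq = refl
      disjoint′ zero    a (suc i′) a′ eq = ⊥-elim (new∉M a i′ a′ (sym eq))
      disjoint′ (suc i) a zero     a′ eq = ⊥-elim (new∉M a′ i a eq)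
      disjoint′ (suc i) a (suc i′) a′ eq = cong suc (disjoint M i a i′ a′ eq)

    Cover : ℕ → Set
    Cover c = Σ (Fin n → Bool) λ U → (∑[ v ∈ vs ] ι (U v)) ≤ c × (∀ y z → Joined y z → T (U y) ⊎ T (U z))

    -- The matching grows greedily; once no edge can be added, its own vertices form a cover.
    matching⊎cover : ∀ j → Matching j ⊎ Cover (j * 2)
    matching⊎cover zero = inj₁ (record { vertex = λ () ; joined = λ () ; disjoint = λ () })
    matching⊎cover (suc j) with matching⊎cover j
    ... | inj₂ (U , size , covers) = inj₂ (U , ≤-trans size (m≤n+m (j * 2) 2) , covers)
    ... | inj₁ M with any? (λ y → any? λ z → joined? y z ×-dec (¬? (covered? M y) ×-dec ¬? (covered? M z)))
    ...   | yes (y , z , yz , y∉M , z∉M) = inj₁ (extend M yz y∉M z∉M)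
    ...   | no  maximal = inj₂ (covered M , ≤-trans (covered-size M) (m≤n+m (j * 2) 2) , covers)
      where
      covers : ∀ y z → Joined y z → T (covered M y) ⊎ T (covered M z)
      covers y z yz with covered? M y | covered? M z
      ... | yes _   | _       = inj₁ tt
      ... | no _    | yes _   = inj₂ tt
      ... | no y∉M  | no z∉M  = ⊥-elim (maximal (y , z , yz , y∉M , z∉M))

    -- Edges of `H` have three vertices, which separates `X` from the matching and the two ends of
    -- each matching edge. `distinct` and `disjoint` exclude the other coincidences.
    matching⇒copy : ∀ {t} → T (distinct X) → Matching t → Contains H (K⁽³⁾ (suc s) t)
    matching⇒copy {t} dX M = f , injective , edges
      where
      fʸ : Fin (t * 2) → Fin n
      fʸ w = vertex M (proj₁ (remQuot {t} 2 w)) (proj₂ (remQuot {t} 2 w))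
      f : Fin (suc s + t * 2) → Fin n
      f v = [ lookup X , fʸ ]′ (splitAt (suc s) v)
      f-x : ∀ x → f (x-vertex {suc s} {t} x) ≡ lookup X x
      f-x x = cong [ lookup X , fʸ ]′ (splitAt-↑ˡ (suc s) x (t * 2))
      f-y : ∀ i a → f (y-vertex {suc s} {t} i a) ≡ vertex M i a
      f-y i a = trans (cong [ lookup X , fʸ ]′ (splitAt-↑ʳ (suc s) (t * 2) (combine i a)))
        (cong (λ (i , a) → vertex M i a) (remQuot-combine {t} i a))
      edge : ∀ x i → Edge H (triple (lookup X x) (vertex M i zero) (vertex M i (suc zero)))
      edge x i = relation⇒Edge (lookup⁺ (joined M i) x)
      view : ∀ v → (∃ λ x → v ≡ x-vertex {suc s} {t} x) ⊎ (∃₂ λ i a → v ≡ y-vertex {suc s} {t} i a)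
      view v with splitAt (suc s) v in eq
      ... | inj₁ x = inj₁ (x , trans (sym (join-splitAt (suc s) (t * 2) v)) (cong (join (suc s) (t * 2)) eq))
      ... | inj₂ w = inj₂ (_ , _ , trans (sym (join-splitAt (suc s) (t * 2) v)) (trans (cong (join (suc s) (t * 2)) eq)
                       (cong (suc s ↑ʳ_) (sym (combine-remQuot {t} 2 w)))))
      x≢vertex : ∀ x i a → lookup X x ≢ vertex M i a
      x≢vertex x i zero       = triple-≢₁₂ (uniform H (edge x i))
      x≢vertex x i (suc zero) = triple-≢₁₂ (uniform H (subst (Edge H) (triple-swap₂₃ _ _ _) (edge x i)))
      vertex-injective : ∀ i a a′ → vertex M i a ≡ vertex M i a′ → a ≡ a′
      vertex-injective i zero       zero       eq = refl
      vertex-injective i zero       (suc zero) eq = ⊥-elim (triple-≢₂₃ {x = lookup X zero} (uniform H (edge zero i)) eq)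
      vertex-injective i (suc zero) zero       eq = ⊥-elim (triple-≢₂₃ {x = lookup X zero} (uniform H (edge zero i)) (sym eq))
      vertex-injective i (suc zero) (suc zero) eq = refl
      injective : ∀ {u v} → f u ≡ f v → u ≡ v
      injective {u} {v} eq with view u | view v
      ... | inj₁ (x , refl)     | inj₁ (x′ , refl)      = cong (x-vertex {suc s} {t})
              (distinct⇒injective X dX x x′ (trans (sym (f-x x)) (trans eq (f-x x′))))
      ... | inj₁ (x , refl)     | inj₂ (i , a , refl)   = ⊥-elim (x≢vertex x i a (trans (sym (f-x x)) (trans eq (f-y i a))))
      ... | inj₂ (i , a , refl) | inj₁ (x , refl)       = ⊥-elim (x≢vertex x i a (trans (sym (f-x x)) (trans (sym eq) (f-y i a))))
      ... | inj₂ (i , a , refl) | inj₂ (i′ , a′ , refl) with trans (sym (f-y i a)) (trans eq (f-y i′ a′))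
      ...   | eq′ with disjoint M i a i′ a′ eq′
      ...     | refl = cong (y-vertex {suc s} {t} i) (vertex-injective i a a′ eq′)
      edges : ∀ e → Edge (K⁽³⁾ (suc s) t) e → Edge H (image f e)
      edges _ (x , i , refl) = subst (Edge H) (sym (trans (image-triple f (x-vertex {suc s} {t} x) (y-vertex {suc s} {t} i zero) (y-vertex {suc s} {t} i (suc zero)))
        (cong₂ (λ p q → ⁅ p ⁆ ∪ q) (f-x x) (cong₂ (λ p q → ⁅ p ⁆ ∪ ⁅ q ⁆) (f-y i zero) (f-y i (suc zero)))))) (edge x i)

    free⇒cover : ∀ {t} → Free (K⁽³⁾ (suc s) t) H → T (distinct X) → Cover (t * 2)
    free⇒cover {t} free dX = [ (λ M → ⊥-elim (free (matching⇒copy dX M))) , id ]′ (matching⊎cover t)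

  free⇒Covering : ∀ {s t} → Free (K⁽³⁾ (suc s) t) H → Covering (suc s) (t * 2) relation
  free⇒Covering {s} {t} free = record
    { U      = λ X → proj₁ (cover X)
    ; size   = λ X → proj₁ (proj₂ (cover X))
    ; covers = λ X → proj₂ (proj₂ (cover X))
    }
    where
    cover : ∀ X → Σ (Fin n → Bool) λ U → (∑[ v ∈ vs ] ι (U v)) ≤ t * 2 ×
            (T (distinct X) → ∀ y z → Joined X y z → T (U y) ⊎ T (U z))
    cover X with distinct X in eq
    ... | true  = let U , size , covers = free⇒cover X {t} free (subst T (sym eq) tt) in U , size , λ _ → covers
    ... | false = (λ _ → false) , ≤-trans (≤-reflexive (∑-zero vs λ _ → refl)) z≤n , λ ()

-- Integer roots and rational exponents

⌈root⌉ : ∀ q .{{_ : NonZero q}} n → ∃ λ m → suc n ≤ suc m ^ q × suc m ^ q ≤ 2 ^ q * suc n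
⌈root⌉ q zero = 0 , ≤-reflexive (sym (^-zeroˡ q)) , ≤-trans (≤-reflexive (^-zeroˡ q)) (≤-trans (m^n>0 2 q) (≤-reflexive (sym (*-identityʳ (2 ^ q)))))
⌈root⌉ q (suc n) with ⌈root⌉ q n
... | m , n≤ , ≤n with suc (suc n) ≤? suc m ^ q
...   | yes n′≤ = m , n′≤ , ≤-trans ≤n (*-monoʳ-≤ (2 ^ q) (n≤1+n (suc n)))
-- The base moves up by one, which raises the power enough and at most doubles the base; the old
-- power lies below the new target, so the factor `2 ^ q` does not accumulate.
...   | no  n′≰ = suc m , ≤-trans (s≤s n≤) (^-monoˡ-< q (n<1+n (suc m))) , (begin
  suc (suc m) ^ q          ≤⟨ ^-monoˡ-≤ q (≤-trans (+-monoʳ-≤ 1 (m≤n+m (suc m) m)) (≤-reflexive (cong (λ e → suc (m + e)) (sym (+-identityʳ (suc m)))))) ⟩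
  (2 * suc m) ^ q          ≡⟨ *-^ 2 (suc m) q ⟩
  2 ^ q * suc m ^ q        ≤⟨ *-monoʳ-≤ (2 ^ q) (<⇒≤ (≰⇒> n′≰)) ⟩
  2 ^ q * suc (suc n)      ∎)
  where open ≤-Reasoning

⊖-cancel : ∀ p {x y} → x ≡ p + y → x ⊖ y ≡ + p
⊖-cancel p {y = y} refl = trans (ℤ.⊖-≥ (m≤n+m y p)) (cong +_ (m+n∸n≡m p y))

≤·^ℚ-intro : ∀ {a C n d p} {α : ℤ} → α ≡ + p → a ^ suc d ≤ C ^ suc d * n ^ p → a ≤ C · n ^ℚ mkℚᵘ α d
≤·^ℚ-intro refl a≤ = a≤

module _ (r′ : ℕ) where

  open Parameters r′ (κ r′)

  private
    κ₀ = pred (κ r′)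
    -- This is 3q - κ - 1 written without subtraction, so that D / q = 3 - 1/(s-1) - 1/q.
    D = 4 + 3 * r′ + κ₀ * (5 + 3 * r′)

  edgeCount-bound : ∀ t .{{_ : NonZero (t * 2)}} m → threshold r′ (t * 2) ≤ m → ∀ {n} → n ≤ m ^ q →
                    (H : Hypergraph 3 n) → Free (K⁽³⁾ s t) H → edgeCount H ≤ m ^ D
  edgeCount-bound t m M≤m n≤N H free = ≤-trans (edgeCount≤total H) (*-cancelˡ-≤ (m ^ 10) {{m^n≢0 m 10}} (begin
    m ^ 10 * total (relation H)     ≤⟨ total-bound r′ (t * 2) m M≤m n≤N (relation H) (relation-sym H) (free⇒Covering H {t = t} free) ⟩
    m ^ (q + q + b)                 ≡⟨ cong (m ^_) (exponents κ₀ r′) ⟩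
    m ^ (10 + D)                    ≡⟨ ^-distribˡ-+-* m 10 D ⟩
    m ^ 10 * m ^ D                  ∎))
    where
    open ≤-Reasoning
    instance
      m-nonZero : NonZero m
      m-nonZero = >-nonZero (≤-trans (>-nonZero⁻¹ _ {{threshold-nonZero r′ (t * 2)}}) M≤m)
    exponents : ∀ κ₀ r′ → suc κ₀ * (2 + r′) + suc κ₀ * (2 + r′) + (suc κ₀ * (1 + r′) + 9) ≡ 10 + (4 + 3 * r′ + κ₀ * (5 + 3 * r′))
    exponents = solve-∀

  ex-bound : ∀ t → ∃ λ C → ∀ n → ex (suc n) (K⁽³⁾ s (suc t)) ^ q ≤ C ^ q * suc n ^ D
  -- The base `M * suc m` reaches the threshold, and its `q`-th power is at most (2M)^q times the
  -- number of vertices. Raising this to the power `D` leaves the constant (2M)^D inside a `q`-th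
  -- power.
  ex-bound t = (2 * M) ^ D , λ n →
    let m , n≤ , ≤n = ⌈root⌉ q n
        G , free , count = ex-attained (K⁽³⁾ s (suc t)) {K-edge {s} {suc t} zero zero} (zero , zero , refl) (suc n)
    in begin
      ex (suc n) (K⁽³⁾ s (suc t)) ^ q
        ≡⟨ cong (_^ q) count ⟨
      edgeCount G ^ q
        ≤⟨ ^-monoˡ-≤ q (edgeCount-bound (suc t) (M * suc m) (m≤m*n M (suc m))
             (≤-trans n≤ (^-monoˡ-≤ q (m≤n*m (suc m) M))) G free) ⟩
      ((M * suc m) ^ D) ^ q
        ≡⟨ ^-exchange (M * suc m) D q ⟩
      ((M * suc m) ^ q) ^ D
        ≤⟨ ^-monoˡ-≤ D (begin
             (M * suc m) ^ q              ≡⟨ *-^ M (suc m) q ⟩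
             M ^ q * suc m ^ q            ≤⟨ *-monoʳ-≤ (M ^ q) ≤n ⟩
             M ^ q * (2 ^ q * suc n)      ≡⟨ *-assoc (M ^ q) (2 ^ q) (suc n) ⟨
             M ^ q * 2 ^ q * suc n        ≡⟨ cong (_* suc n) (trans (*-comm (M ^ q) (2 ^ q)) (sym (*-^ 2 M q))) ⟩
             (2 * M) ^ q * suc n          ∎) ⟩
      ((2 * M) ^ q * suc n) ^ D
        ≡⟨ *-^ ((2 * M) ^ q) (suc n) D ⟩
      ((2 * M) ^ q) ^ D * suc n ^ D
        ≡⟨ cong (_* suc n ^ D) (^-exchange (2 * M) q D) ⟩
      ((2 * M) ^ D) ^ q * suc n ^ D ∎
    where
    open ≤-Reasoning
    M = threshold r′ (suc t * 2)
    instance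
      M-nonZero : NonZero M
      M-nonZero = threshold-nonZero r′ (suc t * 2)
    ^-exchange : ∀ a b c → (a ^ b) ^ c ≡ (a ^ c) ^ b
    ^-exchange a b c = trans (^-*-assoc a b c) (trans (cong (a ^_) (*-comm b c)) (sym (^-*-assoc a c b)))

  -- Unnormalised subtraction leaves the exponent as D (s-1) over (s-1) q, so the inequality is
  -- raised to the power s - 1. The numerator is a natural number, which selects the first clause of
  -- the relation.
  ^-bound⇒≤·^ℚ : ∀ a C n → a ^ q ≤ C ^ q * n ^ D →
                 a ≤ C · n ^ℚ (+ 3 / 1 - (+ 1) / (2 + r′) - mkℚᵘ (+ 1) (pred q))
  ^-bound⇒≤·^ℚ a C n a≤ = ≤·^ℚ-intro {a} {C} {n} {p = D * (2 + r′)} (⊖-cancel (D * (2 + r′)) (numerator κ₀ r′))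
    (subst (λ e → a ^ e ≤ C ^ e * n ^ (D * (2 + r′))) (denominator r′ q) (begin
      a ^ (q * (2 + r′))                                ≡⟨ ^-*-assoc a q (2 + r′) ⟨
      (a ^ q) ^ (2 + r′)                                ≤⟨ ^-monoˡ-≤ (2 + r′) a≤ ⟩
      (C ^ q * n ^ D) ^ (2 + r′)                        ≡⟨ *-^ (C ^ q) (n ^ D) (2 + r′) ⟩
      (C ^ q) ^ (2 + r′) * (n ^ D) ^ (2 + r′)           ≡⟨ cong₂ _*_ (^-*-assoc C q (2 + r′)) (^-*-assoc n D (2 + r′)) ⟩
      C ^ (q * (2 + r′)) * n ^ (D * (2 + r′))           ∎))
    where
    open ≤-Reasoning
    numerator : ∀ κ₀ r → suc (r + 2 * (2 + r)) * (suc κ₀ * (2 + r)) ≡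
                (4 + 3 * r + κ₀ * (5 + 3 * r)) * (2 + r) + suc (suc (r + 0 * (2 + r) + 0 * suc (suc (r + 0 * (2 + r)))))
    numerator = solve-∀
    denominator : ∀ r q → q * (2 + r) ≡ suc (suc (r + 0 * (2 + r))) * q
    denominator = solve-∀

theorem1p3 : (s : ℕ) (3≤s : 3 ≤ s) →
    Σ ℚᵘ λ ε → 0ℚᵘ < ε ×
    ((t : ℕ) → 1 ≤ t →
    Σ ℕ λ C → (n : ℕ) → 1 ≤ n →
    ex n (K⁽³⁾ s t) ≤ C · n ^ℚ (+ 3 / 1 - _/_ (+ 1) (s ∸ 1) {{s∸1-nonZero 3≤s}} - ε))
theorem1p3 (suc (suc (suc r′))) (s≤s (s≤s (s≤s z≤n))) =
  -- ε = 1/q, where q = κ (s-1) and κ depends on `s` alone. The parameter `t` enters only the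
  -- threshold for `m`, and through it the constant.
  mkℚᵘ (+ 1) (pred q) , *<* (ℤ.+<+ (s≤s z≤n)) , λ
    { (suc t) _ → proj₁ (ex-bound r′ t) , λ
      { (suc n) _ → ^-bound⇒≤·^ℚ r′ (ex (suc n) (K⁽³⁾ (3 + r′) (suc t))) (proj₁ (ex-bound r′ t)) (suc n)
                      (proj₂ (ex-bound r′ t) n) } }
  where open Parameters r′ (κ r′)
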